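{- For every $\epsilon>0$ there exist $\delta>0$ and $n_0$ such that the following holds for every $n\ge n_0$. If $G$ is an $n$-vertex graph containing no cycle of length $4$ and containing at most $\delta n^{5/2}$ copies of $C_5$, then $G$ can be made $C_5$-free by removing at most $\epsilon n^{3/2}$ edges.
   Context: $C_k$ denotes the cycle of length $k$; a copy of $C_k$ in $G$ is a subgraph of $G$ isomorphic to $C_k$. The paper states this in asymptotic form: an $n$-vertex $C_4$-free graph with $o(n^{5/2})$ copies of $C_5$ can be made $C_5$-free by removing $o(n^{3/2})$ edges; the claim is the standard quantified meaning of this. -}

module Defs where

open import Data.Nat using (ℕ; zero; suc; _+_; _*_; _∸_; _^_; _≤_; _<_)
open import Data.Nat.DivMod using (_/_)
open import Data.Fin using (Fin; zero; suc; _≟_; _<?_)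
open import Data.Bool using (Bool; true; false; _∧_; not; if_then_else_)
open import Relation.Nullary.Decidable using (⌊_⌋)
open import Relation.Binary.PropositionalEquality using (_≡_)
open import Data.Product using (_×_)

ΣFin : (n : ℕ) → (Fin n → ℕ) → ℕ
ΣFin zero    f = 0
ΣFin (suc n) f = f zero + ΣFin n (λ i → f (suc i))

[_] : Bool → ℕ
[ true ]  = 1
[ false ] = 0

record Graph (n : ℕ) : Set where
  field
    adj   : Fin n → Fin n → Bool
    sym   : ∀ i j → adj i j ≡ adj j i
    irref : ∀ i → adj i i ≡ false
open Graph public

_≠ᵇ_ : ∀ {n} → Fin n → Fin n → Bool
i ≠ᵇ j = not ⌊ i ≟ j ⌋

edges : ∀ {n} → Graph n → ℕ
edges {n} G = ΣFin n λ i → ΣFin n λ j → [ ⌊ i <? j ⌋ ∧ adj G i j ]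

_⊆G_ : ∀ {n} → Graph n → Graph n → Set
H ⊆G G = ∀ i j → adj H i j ≡ true → adj G i j ≡ true

labelledC4 : ∀ {n} → Graph n → ℕ
labelledC4 {n} G =
  ΣFin n λ a → ΣFin n λ b → ΣFin n λ c → ΣFin n λ d →
    [ (a ≠ᵇ b) ∧ (a ≠ᵇ c) ∧ (a ≠ᵇ d) ∧ (b ≠ᵇ c) ∧ (b ≠ᵇ d) ∧ (c ≠ᵇ d)
      ∧ adj G a b ∧ adj G b c ∧ adj G c d ∧ adj G d a ]

labelledC5 : ∀ {n} → Graph n → ℕ
labelledC5 {n} G =
  ΣFin n λ a → ΣFin n λ b → ΣFin n λ c → ΣFin n λ d → ΣFin n λ e →
    [ (a ≠ᵇ b) ∧ (a ≠ᵇ c) ∧ (a ≠ᵇ d) ∧ (a ≠ᵇ e) ∧ (b ≠ᵇ c) ∧ (b ≠ᵇ d)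
      ∧ (b ≠ᵇ e) ∧ (c ≠ᵇ d) ∧ (c ≠ᵇ e) ∧ (d ≠ᵇ e)
      ∧ adj G a b ∧ adj G b c ∧ adj G c d ∧ adj G d e ∧ adj G e a ]

-- Number of copies of C5 (subgraphs isomorphic to C5): each copy corresponds
-- to exactly |Aut(C5)| = 10 labelled 5-cycles, so the division is exact.
copiesC5 : ∀ {n} → Graph n → ℕ
copiesC5 G = labelledC5 G / 10

C4-free : ∀ {n} → Graph n → Set
C4-free G = labelledC4 G ≡ 0

C5-free : ∀ {n} → Graph n → Set
C5-free G = copiesC5 G ≡ 0

{-# OPTIONS --safe #-}
-- Call a set W of vertex pairs sparse if it contains at most |W|/M edges, where M is about √n/ε;
-- sparse sets can be deleted. Starting from W = ∅, add to W the part outside W of a rectangle X × Y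
-- whenever that part is much too sparse; W stays sparse, and after boundedly many steps the complement D
-- of W is lower regular: every rectangle has about |D ∩ (X × Y)|/M edges or more. Since codegrees are
-- at most 1 and degrees are O(√n) after trimming, the pairs of D in a 5-cycle of pairs of D can be
-- replaced by edges of G one at a time, so that G has at least M⁻⁵ times as many 5-cycles as D, up to an
-- error governed by the precision of the regularity. Hence D must have few 5-cycles.
--
-- The precision has to beat the number of cells of a partition, so the process is run in rounds:
-- W₀ (a union of rectangles of the current partition) is enlarged to W with a precision depending on
-- that partition. If |W| exceeds |W₀| by a constant proportion of n², a new round starts from W, which
-- happens boundedly often. Otherwise delete the edges in W₀, those at tiny cells, and those between cells
-- where W ∖ W₀ is relatively dense, which are few by the Kővári–Sós–Turán bound. Every surviving
-- 5-cycle then visits five cells between which D is nearly complete, so D has too many 5-cycles.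
module Submission where

open import Defs
open import Data.Nat using (ℕ; zero; suc; pred; _+_; _*_; _∸_; _^_; _≤_; _<_; z≤n; s≤s; s≤s⁻¹; NonZero; >-nonZero; ≢-nonZero; >-nonZero⁻¹; _≤?_; _<?_; _≟_)
open import Data.Nat.Properties hiding (_≟_; _≤?_; _<?_)
open import Data.Nat.DivMod using (_/_; m≡m%n+[m/n]*n; m%n<n)
open import Data.Nat.Tactic.RingSolver using (solve-∀)
open import Data.Bool using (Bool; true; false; _∧_; _∨_; not)
open import Data.Bool.Properties using (∧-comm; ∧-zeroʳ; ∧-identityʳ; not-involutive)
open import Data.Fin using (Fin; zero; suc; combine)
import Data.Fin as Fin
import Data.Fin.Properties as Finₚ
open import Data.Fin.Subset using (Subset)
open import Data.Fin.Subset.Properties using (anySubset?)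
open import Data.Product using (Σ; ∃; ∃₂; _×_; _,_; proj₁; proj₂)
open import Data.Sum using (_⊎_; inj₁; inj₂)
open import Data.Vec using (lookup; tabulate)
open import Data.Vec.Properties using (lookup∘tabulate)
open import Function using (_∘_; _$_)
open import Relation.Nullary using (¬_; Dec; yes; no; contradiction)
open import Relation.Nullary.Decidable using (⌊_⌋)
open import Relation.Binary.PropositionalEquality
  using (_≡_; _≢_; refl; trans; cong; cong₂; subst; subst₂; module ≡-Reasoning)
  renaming (sym to ≡-sym)

-- Finite sums over `Fin n`.

Σ-cong : ∀ n {f g : Fin n → ℕ} → (∀ i → f i ≡ g i) → ΣFin n f ≡ ΣFin n g
Σ-cong zero    e = refl
Σ-cong (suc n) e = cong₂ _+_ (e zero) (Σ-cong n (e ∘ suc))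

Σ-mono : ∀ n {f g : Fin n → ℕ} → (∀ i → f i ≤ g i) → ΣFin n f ≤ ΣFin n g
Σ-mono zero    e = z≤n
Σ-mono (suc n) e = +-mono-≤ (e zero) (Σ-mono n (e ∘ suc))

Σ-+ : ∀ n (f g : Fin n → ℕ) → ΣFin n (λ i → f i + g i) ≡ ΣFin n f + ΣFin n g
Σ-+ zero    f g = refl
Σ-+ (suc n) f g rewrite Σ-+ n (f ∘ suc) (g ∘ suc) =
  exchange (f zero) (g zero) (ΣFin n (f ∘ suc)) (ΣFin n (g ∘ suc))
  where
  exchange : ∀ a b c d → a + b + (c + d) ≡ a + c + (b + d)
  exchange = solve-∀

Σ-*ˡ : ∀ n c (f : Fin n → ℕ) → ΣFin n (λ i → c * f i) ≡ c * ΣFin n f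
Σ-*ˡ zero    c f = ≡-sym (*-zeroʳ c)
Σ-*ˡ (suc n) c f rewrite Σ-*ˡ n c (f ∘ suc) = ≡-sym (*-distribˡ-+ c (f zero) _)

Σ-*ʳ : ∀ n c (f : Fin n → ℕ) → ΣFin n (λ i → f i * c) ≡ ΣFin n f * c
Σ-*ʳ zero    c f = refl
Σ-*ʳ (suc n) c f rewrite Σ-*ʳ n c (f ∘ suc) = ≡-sym (*-distribʳ-+ c (f zero) _)

Σ-const : ∀ n c → ΣFin n (λ _ → c) ≡ n * c
Σ-const zero    c = refl
Σ-const (suc n) c = cong (c +_) (Σ-const n c)

Σ-bound : ∀ n c {f : Fin n → ℕ} → (∀ i → f i ≤ c) → ΣFin n f ≤ n * c
Σ-bound n c {f} f≤c = subst (ΣFin n f ≤_) (Σ-const n c) (Σ-mono n f≤c)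

Σ-swap : ∀ n m (F : Fin n → Fin m → ℕ) →
  ΣFin n (λ i → ΣFin m (F i)) ≡ ΣFin m (λ j → ΣFin n (λ i → F i j))
Σ-swap zero    m F = ≡-sym (trans (Σ-const m 0) (*-zeroʳ m))
Σ-swap (suc n) m F = trans (cong (ΣFin m (F zero) +_) (Σ-swap n m (F ∘ suc)))
                           (≡-sym (Σ-+ m (F zero) (λ j → ΣFin n (λ i → F (suc i) j))))

Σ-zero : ∀ n {f : Fin n → ℕ} → (∀ i → f i ≡ 0) → ΣFin n f ≡ 0
Σ-zero n e = trans (Σ-cong n e) (trans (Σ-const n 0) (*-zeroʳ n))

Σ-zero⁻¹ : ∀ n (f : Fin n → ℕ) → ΣFin n f ≡ 0 → ∀ i → f i ≡ 0
Σ-zero⁻¹ (suc n) f e zero    = m+n≡0⇒m≡0 (f zero) e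
Σ-zero⁻¹ (suc n) f e (suc i) = Σ-zero⁻¹ n (f ∘ suc) (m+n≡0⇒n≡0 (f zero) e) i

Σ-nonzero : ∀ n (f : Fin n → ℕ) → ΣFin n f ≢ 0 → ∃ λ i → f i ≢ 0
Σ-nonzero zero    f ne = contradiction refl ne
Σ-nonzero (suc n) f ne with f zero ≟ 0
... | no  f₀≢0 = zero , f₀≢0
... | yes f₀≡0 with Σ-nonzero n (f ∘ suc) (λ e → ne (cong₂ _+_ f₀≡0 e))
...   | i , fᵢ≢0 = suc i , fᵢ≢0

-- Meant for codegrees: one nonzero value forces all the others to vanish, so at most a single 1 is
-- left.
Σ-at-most-one : ∀ n (f : Fin n → ℕ) → (∀ i → f i ≤ 1) →
  (∀ i j → i ≢ j → f i * f j ≡ 0) → ΣFin n f ≤ 1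
Σ-at-most-one zero    f f≤1 disj = z≤n
Σ-at-most-one (suc n) f f≤1 disj with f zero in eq
... | zero  = Σ-at-most-one n (f ∘ suc) (f≤1 ∘ suc)
                (λ i j i≢j → disj (suc i) (suc j) (i≢j ∘ Finₚ.suc-injective))
... | suc v = ≤-reflexive (trans (cong (suc v +_) rest) (trans (+-identityʳ _) v+1≡1))
  where
  v+1≡1 : suc v ≡ 1
  v+1≡1 = ≤-antisym (subst (_≤ 1) eq (f≤1 zero)) (s≤s z≤n)
  rest : ΣFin n (f ∘ suc) ≡ 0
  rest = Σ-zero n λ i → m+n≡0⇒m≡0 (f (suc i))
           (subst (λ w → w * f (suc i) ≡ 0) eq (disj zero (suc i) λ ()))

-- Indicators, double sums, and sums split along a partition.

infix 4 _==_
_==_ : ∀ {n} → Fin n → Fin n → Bool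
i == j = ⌊ i Fin.≟ j ⌋

==-suc : ∀ {n} (i j : Fin n) → (suc i == suc j) ≡ (i == j)
==-suc i j with i Fin.≟ j
... | yes _ = refl
... | no  _ = refl

==-sym : ∀ {n} (i j : Fin n) → (i == j) ≡ (j == i)
==-sym i j with i Fin.≟ j | j Fin.≟ i
... | yes _ | yes _ = refl
... | no  _ | no  _ = refl
... | yes p | no  q = contradiction (≡-sym p) q
... | no  p | yes q = contradiction (≡-sym q) p

Σ-δ : ∀ n (i : Fin n) (f : Fin n → ℕ) → ΣFin n (λ j → [ i == j ] * f j) ≡ f i
Σ-δ (suc n) zero    f = trans (cong₂ _+_ (+-identityʳ (f zero)) (Σ-zero n λ _ → refl)) (+-identityʳ _)
Σ-δ (suc n) (suc i) f = trans (Σ-cong n λ j → cong (λ b → [ b ] * f (suc j)) (==-suc i j)) (Σ-δ n i (f ∘ suc))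

-- Inserting a Kronecker delta at `P x` and exchanging the sums turns the dependence on the cell of
-- `x` into a free index `i`.
Σ-partition : ∀ n k (P : Fin n → Fin k) (F : Fin k → Fin n → ℕ) →
  ΣFin n (λ x → F (P x) x) ≡ ΣFin k (λ i → ΣFin n (λ x → [ P x == i ] * F i x))
Σ-partition n k P F = trans
  (Σ-cong n λ x → ≡-sym (Σ-δ k (P x) (λ i → F i x)))
  (Σ-swap n k _)

[]≤1 : ∀ b → [ b ] ≤ 1
[]≤1 true  = ≤-refl
[]≤1 false = z≤n

[∧] : ∀ a b → [ a ∧ b ] ≡ [ a ] * [ b ]
[∧] true  b = ≡-sym (+-identityʳ _)
[∧] false b = refl

[]≢0 : ∀ b → [ b ] ≢ 0 → b ≡ true
[]≢0 true  _  = refl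
[]≢0 false ne = contradiction refl ne

[]*≤ : ∀ b m → [ b ] * m ≤ m
[]*≤ true  m = ≤-reflexive (+-identityʳ m)
[]*≤ false m = z≤n

∧-true : ∀ a b → a ∧ b ≡ true → a ≡ true × b ≡ true
∧-true true true _ = refl , refl

Σ² : ∀ n → (Fin n → Fin n → ℕ) → ℕ
Σ² n F = ΣFin n λ x → ΣFin n λ y → F x y

Σ²-cong : ∀ n {F F′ : Fin n → Fin n → ℕ} → (∀ x y → F x y ≡ F′ x y) → Σ² n F ≡ Σ² n F′
Σ²-cong n e = Σ-cong n λ x → Σ-cong n (e x)

Σ²-mono : ∀ n {F F′ : Fin n → Fin n → ℕ} → (∀ x y → F x y ≤ F′ x y) → Σ² n F ≤ Σ² n F′
Σ²-mono n e = Σ-mono n λ x → Σ-mono n (e x)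

Σ²-+ : ∀ n (F F′ : Fin n → Fin n → ℕ) → Σ² n (λ x y → F x y + F′ x y) ≡ Σ² n F + Σ² n F′
Σ²-+ n F F′ = trans (Σ-cong n λ x → Σ-+ n (F x) (F′ x)) (Σ-+ n _ _)

Σ²-*ˡ : ∀ n c (F : Fin n → Fin n → ℕ) → Σ² n (λ x y → c * F x y) ≡ c * Σ² n F
Σ²-*ˡ n c F = trans (Σ-cong n λ x → Σ-*ˡ n c (F x)) (Σ-*ˡ n c _)

Σ²-bound : ∀ n c {F : Fin n → Fin n → ℕ} → (∀ x y → F x y ≤ c) → Σ² n F ≤ n * (n * c)
Σ²-bound n c F≤c = Σ-bound n (n * c) λ x → Σ-bound n c (F≤c x)

Σ²-product : ∀ n (u v : Fin n → ℕ) → Σ² n (λ x y → u x * v y) ≡ ΣFin n u * ΣFin n v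
Σ²-product n u v = trans (Σ-cong n λ x → Σ-*ˡ n (u x) v) (Σ-*ʳ n (ΣFin n v) u)

Σ²-partition : ∀ n k (P : Fin n → Fin k) (F : Fin k → Fin k → Fin n → Fin n → ℕ) →
  Σ² n (λ x y → F (P x) (P y) x y) ≡
  Σ² k (λ i j → Σ² n (λ x y → [ P x == i ] * [ P y == j ] * F i j x y))
Σ²-partition n k P F = begin
  Σ² n (λ x y → F (P x) (P y) x y)
    ≡⟨ Σ-partition n k P (λ i x → ΣFin n λ y → F i (P y) x y) ⟩
  ΣFin k (λ i → ΣFin n λ x → [ P x == i ] * ΣFin n λ y → F i (P y) x y)
    ≡⟨ Σ-cong k (λ i → Σ-cong n λ x → cong ([ P x == i ] *_) (Σ-partition n k P (λ j y → F i j x y))) ⟩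
  ΣFin k (λ i → ΣFin n λ x → [ P x == i ] * ΣFin k λ j → ΣFin n λ y → [ P y == j ] * F i j x y)
    ≡⟨ Σ-cong k (λ i → Σ-cong n λ x → ≡-sym (Σ-*ˡ k [ P x == i ] _)) ⟩
  ΣFin k (λ i → ΣFin n λ x → ΣFin k λ j → [ P x == i ] * ΣFin n λ y → [ P y == j ] * F i j x y)
    ≡⟨ Σ-cong k (λ i → Σ-swap n k _) ⟩
  ΣFin k (λ i → ΣFin k λ j → ΣFin n λ x → [ P x == i ] * ΣFin n λ y → [ P y == j ] * F i j x y)
    ≡⟨ Σ²-cong k (λ i j → Σ-cong n λ x → trans (≡-sym (Σ-*ˡ n [ P x == i ] _))
         (Σ-cong n λ y → ≡-sym (*-assoc [ P x == i ] [ P y == j ] _))) ⟩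
  Σ² k (λ i j → Σ² n (λ x y → [ P x == i ] * [ P y == j ] * F i j x y)) ∎
  where open ≡-Reasoning

-- Traces of products of matrices over ℕ

Mat : ℕ → Set
Mat n = Fin n → Fin n → ℕ

infixr 7 _⊗_
_⊗_ : ∀ {n} → Mat n → Mat n → Mat n
_⊗_ {n} A B x y = ΣFin n λ z → A x z * B z y

tr : ∀ {n} → Mat n → ℕ
tr {n} A = ΣFin n λ x → A x x

infix 4 _≐_
_≐_ : ∀ {n} → Mat n → Mat n → Set
A ≐ B = ∀ x y → A x y ≡ B x y

module _ {n : ℕ} where

  ⊗-congʳ : ∀ (A : Mat n) {B B′ : Mat n} → B ≐ B′ → A ⊗ B ≐ A ⊗ B′
  ⊗-congʳ A e x y = Σ-cong n λ z → cong (A x z *_) (e z y)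

  ⊗-assoc : ∀ (A B C : Mat n) → (A ⊗ B) ⊗ C ≐ A ⊗ (B ⊗ C)
  ⊗-assoc A B C x y = begin
    ΣFin n (λ z → ΣFin n (λ w → A x w * B w z) * C z y)
      ≡⟨ Σ-cong n (λ z → ≡-sym (Σ-*ʳ n (C z y) (λ w → A x w * B w z))) ⟩
    ΣFin n (λ z → ΣFin n (λ w → A x w * B w z * C z y))
      ≡⟨ Σ-swap n n _ ⟩
    ΣFin n (λ w → ΣFin n (λ z → A x w * B w z * C z y))
      ≡⟨ Σ-cong n (λ w → trans (Σ-cong n λ z → *-assoc (A x w) _ _) (Σ-*ˡ n (A x w) _)) ⟩
    ΣFin n (λ w → A x w * ΣFin n (λ z → B w z * C z y)) ∎
    where open ≡-Reasoning

  tr-comm : ∀ (A B : Mat n) → tr (A ⊗ B) ≡ tr (B ⊗ A)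
  tr-comm A B = trans (Σ-swap n n _) (Σ²-cong n λ x y → *-comm (A y x) (B x y))

  tr-congʳ : ∀ (A : Mat n) {B B′ : Mat n} → B ≐ B′ → tr (A ⊗ B) ≡ tr (A ⊗ B′)
  tr-congʳ A e = Σ-cong n λ x → ⊗-congʳ A e x x

  tr₅ : (A B C D E : Mat n) → ℕ
  tr₅ A B C D E = tr (A ⊗ B ⊗ C ⊗ D ⊗ E)

  -- Cyclicity of the trace, which lets `countingLemma` bring any of the five kernels to the front.
  tr₅-rotate : ∀ A B C D E → tr₅ A B C D E ≡ tr₅ B C D E A
  tr₅-rotate A B C D E = begin
    tr (A ⊗ B ⊗ C ⊗ D ⊗ E)       ≡⟨ tr-comm A _ ⟩
    tr ((B ⊗ C ⊗ D ⊗ E) ⊗ A)     ≡⟨ Σ-cong n (λ x → ⊗-assoc B _ A x x) ⟩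
    tr (B ⊗ ((C ⊗ D ⊗ E) ⊗ A))   ≡⟨ tr-congʳ B (⊗-assoc C _ A) ⟩
    tr (B ⊗ C ⊗ ((D ⊗ E) ⊗ A))   ≡⟨ tr-congʳ B (⊗-congʳ C (⊗-assoc D E A)) ⟩
    tr (B ⊗ C ⊗ D ⊗ E ⊗ A)       ∎
    where open ≡-Reasoning

  -- `replaceKernel` expects the kernel times a product of two matrices. The four remaining factors
  -- are grouped as 2 + 2 here and as 3 + 1 in `tr₅-bracket₃₁`.
  tr₅-bracket₂₂ : ∀ A B C D E → tr (A ⊗ ((B ⊗ C) ⊗ (D ⊗ E))) ≡ tr₅ A B C D E
  tr₅-bracket₂₂ A B C D E = tr-congʳ A (⊗-assoc B C (D ⊗ E))

  tr₅-bracket₃₁ : ∀ A B C D E → tr (A ⊗ ((B ⊗ (C ⊗ D)) ⊗ E)) ≡ tr₅ A B C D E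
  tr₅-bracket₃₁ A B C D E = trans (tr-congʳ A (⊗-assoc B (C ⊗ D) E))
                                  (tr-congʳ A (⊗-congʳ B (⊗-assoc C D E)))

  ⊗-bound : ∀ (A B : Mat n) {a b} → (∀ x → ΣFin n (A x) ≤ a) → (∀ x y → B x y ≤ b) →
    ∀ x y → (A ⊗ B) x y ≤ a * b
  ⊗-bound A B {a} {b} A≤ B≤ x y = begin
    ΣFin n (λ z → A x z * B z y) ≤⟨ Σ-mono n (λ z → *-monoʳ-≤ (A x z) (B≤ z y)) ⟩
    ΣFin n (λ z → A x z * b)     ≡⟨ Σ-*ʳ n b (A x) ⟩
    ΣFin n (A x) * b             ≤⟨ *-monoˡ-≤ b (A≤ x) ⟩
    a * b                        ∎
    where open ≤-Reasoning

  ⊗-bound₁ : ∀ (A B : Mat n) {a} → (∀ x → ΣFin n (A x) ≤ a) → (∀ x y → B x y ≤ 1) →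
    ∀ x y → (A ⊗ B) x y ≤ a
  ⊗-bound₁ A B {a} A≤ B≤1 x y = subst ((A ⊗ B) x y ≤_) (*-identityʳ a) (⊗-bound A B A≤ B≤1 x y)

  rowSum-bound : ∀ (A : Mat n) {b} → (∀ x y → A x y ≤ b) → ∀ x → ΣFin n (A x) ≤ n * b
  rowSum-bound A {b} A≤ x = Σ-bound n b (A≤ x)

-- One-sided cut-norm closeness of a kernel to a multiple of a sparse one

bil : ∀ {n} → Mat n → (u v : Fin n → ℕ) → ℕ
bil {n} K u v = Σ² n λ x y → K x y * (u x * v y)

-- The error is `n²/z`, so `1/z` is the precision; everything is multiplied by `z` to stay in ℕ. In
-- the application `K` is the complement of the sparse set, `g` the adjacency matrix and `1/M` the
-- edge density aimed at.
LowerRegular : ∀ {n} → ℕ → ℕ → Mat n → Mat n → Set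
LowerRegular {n} z M K g = ∀ (X Y : Fin n → Bool) →
  z * bil K (λ x → [ X x ]) (λ y → [ Y y ]) ≤ z * M * bil g (λ x → [ X x ]) (λ y → [ Y y ]) + n * n

BilinearRegular : ∀ {n} → ℕ → ℕ → Mat n → Mat n → Set
BilinearRegular {n} z M K g = ∀ a b (u v : Fin n → ℕ) → (∀ x → u x ≤ a) → (∀ y → v y ≤ b) →
  z * bil K u v ≤ z * M * bil g u v + a * b * (n * n)

positive : ℕ → Bool
positive zero    = false
positive (suc _) = true

-- Peels off one superlevel set: the indicator takes values 0 and 1, and `pred` lowers the sup norm
-- by 1.
pred+positive : ∀ m → m ≡ pred m + [ positive m ]
pred+positive zero    = refl
pred+positive (suc m) = +-comm 1 m

module _ {n : ℕ} where

  bil-+ˡ : ∀ (K : Mat n) u u′ v → bil K (λ x → u x + u′ x) v ≡ bil K u v + bil K u′ v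
  bil-+ˡ K u u′ v = trans (Σ²-cong n λ x y → split (K x y) (u x) (u′ x) (v y)) (Σ²-+ n _ _)
    where
    split : ∀ k a b c → k * ((a + b) * c) ≡ k * (a * c) + k * (b * c)
    split = solve-∀

  bil-+ʳ : ∀ (K : Mat n) u v v′ → bil K u (λ y → v y + v′ y) ≡ bil K u v + bil K u v′
  bil-+ʳ K u v v′ = trans (Σ²-cong n λ x y → split (K x y) (u x) (v y) (v′ y)) (Σ²-+ n _ _)
    where
    split : ∀ k a b c → k * (a * (b + c)) ≡ k * (a * b) + k * (a * c)
    split = solve-∀

  bil-cong : ∀ (K : Mat n) {u u′ v v′} → (∀ x → u x ≡ u′ x) → (∀ y → v y ≡ v′ y) →
    bil K u v ≡ bil K u′ v′
  bil-cong K eu ev = Σ²-cong n λ x y → cong (K x y *_) (cong₂ _*_ (eu x) (ev y))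

  bil-mono : ∀ {K K′ : Mat n} {u u′ v v′} → (∀ x y → K x y ≤ K′ x y) →
    (∀ x → u x ≤ u′ x) → (∀ y → v y ≤ v′ y) → bil K u v ≤ bil K′ u′ v′
  bil-mono eK eu ev = Σ²-mono n λ x y → *-mono-≤ (eK x y) (*-mono-≤ (eu x) (ev y))

  bil-zero : ∀ (K : Mat n) u v → (∀ x y → u x * v y ≡ 0) → bil K u v ≡ 0
  bil-zero K u v e = Σ-zero n λ x → Σ-zero n λ y → trans (cong (K x y *_) (e x y)) (*-zeroʳ (K x y))

  private
    merge : ∀ z zM {A B h} a b c d e f N → A ≡ a + c → B ≡ b + d → h ≡ e + f →
      z * a ≤ zM * b + e * N → z * c ≤ zM * d + f * N → z * A ≤ zM * B + h * N
    merge z zM a b c d e f N refl refl refl p q = begin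
      z * (a + c)                          ≡⟨ *-distribˡ-+ z a c ⟩
      z * a + z * c                        ≤⟨ +-mono-≤ p q ⟩
      (zM * b + e * N) + (zM * d + f * N)  ≡⟨ rearrange zM b d e f N ⟩
      zM * (b + d) + (e + f) * N           ∎
      where
      open ≤-Reasoning
      rearrange : ∀ zM b d e f N → (zM * b + e * N) + (zM * d + f * N) ≡ zM * (b + d) + (e + f) * N
      rearrange = solve-∀

  -- A function with values in {0,…,a} is a sum of a indicator functions (its superlevel sets),
  -- so the error made on sets is multiplied by the two sup norms.
  lowerRegular⇒bilinearRegular : ∀ z M (K g : Mat n) → LowerRegular z M K g → BilinearRegular z M K g
  lowerRegular⇒bilinearRegular z M K g reg = functions
    where
    vanishing : ∀ u v {c} → (∀ x y → u x * v y ≡ 0) → z * bil K u v ≤ c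
    vanishing u v uv≡0 = ≤-trans (≤-reflexive (trans (cong (z *_) (bil-zero K u v uv≡0)) (*-zeroʳ z))) z≤n
    setFunction : ∀ b (X : Fin n → Bool) v → (∀ y → v y ≤ b) →
      z * bil K (λ x → [ X x ]) v ≤ z * M * bil g (λ x → [ X x ]) v + b * (n * n)
    setFunction zero X v v≤ = vanishing (λ x → [ X x ]) v λ x y →
        trans (cong ([ X x ] *_) (n≤0⇒n≡0 (v≤ y))) (*-zeroʳ [ X x ])
    setFunction (suc b) X v v≤ =
      merge z (z * M) (bil K χ v⁻) (bil g χ v⁻) (bil K χ v⁺) (bil g χ v⁺) b 1 (n * n)
        (decompose K) (decompose g) (+-comm 1 b)
        (setFunction b X v⁻ (λ y → ∸-monoˡ-≤ 1 (v≤ y)))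
        (≤-trans (reg X (λ y → positive (v y))) (+-monoʳ-≤ _ (≤-reflexive (≡-sym (+-identityʳ (n * n))))))
      where
      χ v⁻ v⁺ : Fin n → ℕ
      χ x = [ X x ]
      v⁻ y = pred (v y)
      v⁺ y = [ positive (v y) ]
      decompose : ∀ (L : Mat n) → bil L χ v ≡ bil L χ v⁻ + bil L χ v⁺
      decompose L = trans (bil-cong L {χ} (λ _ → refl) (λ y → pred+positive (v y))) (bil-+ʳ L χ v⁻ v⁺)
    functions : BilinearRegular z M K g
    functions zero b u v u≤ v≤ = vanishing u v λ x y → cong (_* v y) (n≤0⇒n≡0 (u≤ x))
    functions (suc a) b u v u≤ v≤ =
      merge z (z * M) (bil K u⁻ v) (bil g u⁻ v) (bil K u⁺ v) (bil g u⁺ v) (a * b) b (n * n)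
        (decompose K) (decompose g) (+-comm b (a * b))
        (functions a b u⁻ v (λ x → ∸-monoˡ-≤ 1 (u≤ x)) v≤)
        (setFunction b (λ x → positive (u x)) v v≤)
      where
      u⁻ u⁺ : Fin n → ℕ
      u⁻ x = pred (u x)
      u⁺ x = [ positive (u x) ]
      decompose : ∀ (L : Mat n) → bil L u v ≡ bil L u⁻ v + bil L u⁺ v
      decompose L = trans (bil-cong L {v = v} (λ x → pred+positive (u x)) (λ _ → refl)) (bil-+ˡ L u⁻ u⁺ v)

  restrict : Mat n → (χ χ′ : Fin n → Bool) → Mat n
  restrict K χ χ′ x y = [ χ x ] * [ χ′ y ] * K x y

  -- The two indicators move from the kernel into `u` and `v` without raising the sup norms. On the
  -- side of `g` they are dropped again, which can only enlarge the upper bound.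
  bilinearRegular-restrict : ∀ z M (K g : Mat n) χ χ′ →
    BilinearRegular z M K g → BilinearRegular z M (restrict K χ χ′) g
  bilinearRegular-restrict z M K g χ χ′ reg a b u v u≤ v≤ = begin
    z * bil (restrict K χ χ′) u v
      ≡⟨ cong (z *_) (Σ²-cong n λ x y → rearrange [ χ x ] [ χ′ y ] (K x y) (u x) (v y)) ⟩
    z * bil K (λ x → [ χ x ] * u x) (λ y → [ χ′ y ] * v y)
      ≤⟨ reg a b _ _ (λ x → ≤-trans ([]*≤ (χ x) _) (u≤ x)) (λ y → ≤-trans ([]*≤ (χ′ y) _) (v≤ y)) ⟩
    z * M * bil g (λ x → [ χ x ] * u x) (λ y → [ χ′ y ] * v y) + a * b * (n * n)
      ≤⟨ +-monoˡ-≤ _ (*-monoʳ-≤ (z * M) (bil-mono {g} {g} {u′ = u} {v′ = v} (λ _ _ → ≤-refl) (λ x → []*≤ (χ x) _) (λ y → []*≤ (χ′ y) _))) ⟩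
    z * M * bil g u v + a * b * (n * n) ∎
    where
    open ≤-Reasoning
    rearrange : ∀ p q k u v → p * q * k * (u * v) ≡ k * (p * u * (q * v))
    rearrange = solve-∀

  -- Once the vertex `p` between `α` and `γ` is fixed, the two ends of `K` are weighted
  -- independently. So the trace is a sum over `p` of bilinear forms.
  tr-bil : ∀ (K α γ : Mat n) → tr (K ⊗ (α ⊗ γ)) ≡ ΣFin n λ p → bil K (γ p) (λ y → α y p)
  tr-bil K α γ = begin
    Σ² n (λ x y → K x y * ΣFin n (λ p → α y p * γ p x))
      ≡⟨ Σ²-cong n (λ x y → trans (≡-sym (Σ-*ˡ n (K x y) _))
           (Σ-cong n λ p → cong (K x y *_) (*-comm (α y p) (γ p x)))) ⟩
    ΣFin n (λ x → ΣFin n λ y → ΣFin n λ p → K x y * (γ p x * α y p))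
      ≡⟨ Σ-cong n (λ x → Σ-swap n n _) ⟩
    ΣFin n (λ x → ΣFin n λ p → ΣFin n λ y → K x y * (γ p x * α y p))
      ≡⟨ Σ-swap n n _ ⟩
    ΣFin n (λ p → bil K (γ p) (λ y → α y p)) ∎
    where open ≡-Reasoning

  -- Regularity is used once for each vertex `p` of `tr-bil`; this is the third factor `n` of the
  -- error.
  replaceKernel : ∀ z M (K g : Mat n) → BilinearRegular z M K g → ∀ (α γ : Mat n) {a b} →
    (∀ x y → α x y ≤ a) → (∀ x y → γ x y ≤ b) →
    z * tr (K ⊗ (α ⊗ γ)) ≤ z * M * tr (g ⊗ (α ⊗ γ)) + a * b * (n * n * n)
  replaceKernel z M K g reg α γ {a} {b} α≤ γ≤ = begin
    z * tr (K ⊗ (α ⊗ γ))                                      ≡⟨ cong (z *_) (tr-bil K α γ) ⟩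
    z * ΣFin n (λ p → bil K (γ p) (λ y → α y p))              ≡⟨ Σ-*ˡ n z _ ⟨
    ΣFin n (λ p → z * bil K (γ p) (λ y → α y p))
      ≤⟨ Σ-mono n (λ p → reg b a (γ p) (λ y → α y p) (γ≤ p) (λ y → α≤ y p)) ⟩
    ΣFin n (λ p → z * M * bil g (γ p) (λ y → α y p) + b * a * (n * n))
      ≡⟨ trans (Σ-+ n _ _) (cong₂ _+_ (Σ-*ˡ n (z * M) _) (Σ-const n _)) ⟩
    z * M * ΣFin n (λ p → bil g (γ p) (λ y → α y p)) + n * (b * a * (n * n))
      ≡⟨ cong₂ (λ s t → z * M * s + t) (≡-sym (tr-bil g α γ)) (rearrange n a b) ⟩
    z * M * tr (g ⊗ (α ⊗ γ)) + a * b * (n * n * n) ∎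
    where
    open ≤-Reasoning
    rearrange : ∀ n a b → n * (b * a * (n * n)) ≡ a * b * (n * n * n)
    rearrange = solve-∀

-- Sums over five vertices.

Σ⁵ : ∀ n → (Fin n → Fin n → Fin n → Fin n → Fin n → ℕ) → ℕ
Σ⁵ n F = ΣFin n λ a → ΣFin n λ b → ΣFin n λ c → ΣFin n λ d → ΣFin n λ e → F a b c d e

Σ⁵-mono : ∀ n {F F′ : Fin n → Fin n → Fin n → Fin n → Fin n → ℕ} →
  (∀ a b c d e → F a b c d e ≤ F′ a b c d e) → Σ⁵ n F ≤ Σ⁵ n F′
Σ⁵-mono n h = Σ²-mono n λ a b → Σ²-mono n λ c d → Σ-mono n (h a b c d)

Σ⁵-+ : ∀ n (F F′ : Fin n → Fin n → Fin n → Fin n → Fin n → ℕ) →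
  Σ⁵ n (λ a b c d e → F a b c d e + F′ a b c d e) ≡ Σ⁵ n F + Σ⁵ n F′
Σ⁵-+ n F F′ = trans
  (Σ²-cong n λ a b → trans (Σ²-cong n λ c d → Σ-+ n (F a b c d) (F′ a b c d)) (Σ²-+ n _ _))
  (Σ²-+ n _ _)

-- Moves a constrained pair of consecutive vertices to the first two places, where `Σ⁵-factor`
-- applies.
Σ⁵-rotate : ∀ n (F : Fin n → Fin n → Fin n → Fin n → Fin n → ℕ) →
  Σ⁵ n F ≡ Σ⁵ n (λ a b c d e → F e a b c d)
Σ⁵-rotate n F = trans (Σ-swap n n _) (Σ-cong n λ b →
  trans (Σ-swap n n _) (Σ-cong n λ c →
  trans (Σ-swap n n _) (Σ-cong n λ d → Σ-swap n n _)))

Σ⁵-factor : ∀ n (F : Fin n → Fin n → ℕ) (u v w : Fin n → ℕ) →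
  Σ⁵ n (λ a b c d e → F a b * (u c * (v d * w e))) ≡ Σ² n F * (ΣFin n u * (ΣFin n v * ΣFin n w))
Σ⁵-factor n F u v w = begin
  Σ⁵ n (λ a b c d e → F a b * (u c * (v d * w e)))
    ≡⟨ Σ²-cong n (λ a b → inner (F a b)) ⟩
  Σ² n (λ a b → F a b * (ΣFin n u * (ΣFin n v * ΣFin n w)))
    ≡⟨ trans (Σ-cong n λ a → Σ-*ʳ n _ (F a)) (Σ-*ʳ n _ _) ⟩
  Σ² n F * (ΣFin n u * (ΣFin n v * ΣFin n w)) ∎
  where
  open ≡-Reasoning
  inner : ∀ f → ΣFin n (λ c → ΣFin n λ d → ΣFin n λ e → f * (u c * (v d * w e))) ≡
    f * (ΣFin n u * (ΣFin n v * ΣFin n w))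
  inner f = begin
    ΣFin n (λ c → ΣFin n λ d → ΣFin n λ e → f * (u c * (v d * w e)))
      ≡⟨ Σ-cong n (λ c → trans (Σ-cong n λ d → Σ-*ˡ n f _) (Σ-*ˡ n f _)) ⟩
    ΣFin n (λ c → f * Σ² n (λ d e → u c * (v d * w e)))
      ≡⟨ Σ-*ˡ n f _ ⟩
    f * ΣFin n (λ c → Σ² n (λ d e → u c * (v d * w e)))
      ≡⟨ cong (f *_) (Σ-cong n λ c → trans (Σ²-*ˡ n (u c) _) (cong (u c *_) (Σ²-product n v w))) ⟩
    f * ΣFin n (λ c → u c * (ΣFin n v * ΣFin n w))
      ≡⟨ cong (f *_) (Σ-*ʳ n _ u) ⟩
    f * (ΣFin n u * (ΣFin n v * ΣFin n w)) ∎

tr₅-expand : ∀ {n} (A B C D E : Mat n) →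
  tr₅ A B C D E ≡ Σ⁵ n (λ a b c d e → A a b * (B b c * (C c d * (D d e * E e a))))
tr₅-expand {n} A B C D E = Σ²-cong n λ a b → begin
  A a b * ΣFin n (λ c → B b c * ΣFin n λ d → C c d * ΣFin n λ e → D d e * E e a)
    ≡⟨ Σ-*ˡ n (A a b) _ ⟨
  ΣFin n (λ c → A a b * (B b c * ΣFin n λ d → C c d * ΣFin n λ e → D d e * E e a))
    ≡⟨ Σ-cong n (λ c → trans (cong (A a b *_) (≡-sym (Σ-*ˡ n (B b c) _))) (≡-sym (Σ-*ˡ n (A a b) _))) ⟩
  Σ² n (λ c d → A a b * (B b c * (C c d * ΣFin n λ e → D d e * E e a)))
    ≡⟨ Σ²-cong n (λ c d → trans (cong (λ t → A a b * (B b c * t)) (≡-sym (Σ-*ˡ n (C c d) _)))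
         (trans (cong (A a b *_) (≡-sym (Σ-*ˡ n (B b c) _))) (≡-sym (Σ-*ˡ n (A a b) _)))) ⟩
  ΣFin n (λ c → ΣFin n λ d → ΣFin n λ e → A a b * (B b c * (C c d * (D d e * E e a)))) ∎
  where open ≡-Reasoning

-- Graphs with codegrees at most 1 and degrees at most d

edge : ∀ {n} → Graph n → Mat n
edge G x y = [ adj G x y ]

degree : ∀ {n} → Graph n → Fin n → ℕ
degree {n} G x = ΣFin n (edge G x)

CodegreeAtMostOne : ∀ {n} → Graph n → Set
CodegreeAtMostOne G = ∀ x y → x ≢ y → (edge G ⊗ edge G) x y ≤ 1

≠ᵇ-sym : ∀ {n} (x y : Fin n) → (x ≠ᵇ y) ≡ (y ≠ᵇ x)
≠ᵇ-sym x y = cong not (==-sym x y)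

adj⇒≢ : ∀ {n} (G : Graph n) x y → adj G x y ≡ true → x ≢ y
adj⇒≢ G x .x e refl with trans (≡-sym e) (irref G x)
... | ()

≢⇒≠ᵇ : ∀ {n} (x y : Fin n) → x ≢ y → (x ≠ᵇ y) ≡ true
≢⇒≠ᵇ x y ne with x Fin.≟ y
... | yes e = contradiction e ne
... | no  _ = refl

adj⇒≠ᵇ : ∀ {n} (G : Graph n) x y → adj G x y ≡ true → (x ≠ᵇ y) ≡ true
adj⇒≠ᵇ G x y e = ≢⇒≠ᵇ x y (adj⇒≢ G x y e)

module Counting {n} (G : Graph n) (d : ℕ)
  (codegree≤1 : CodegreeAtMostOne G) (degree≤d : ∀ x → degree G x ≤ d) where

  private
    g : Mat n
    g = edge G

  -- On the diagonal `cod` is the degree, too large for a sup norm. `path₂` omits the diagonal and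
  -- so has values at most 1.
  cod path₂ : Mat n
  cod = g ⊗ g
  path₂ x y = [ x ≠ᵇ y ] * cod x y

  path₂≤1 : ∀ x y → path₂ x y ≤ 1
  path₂≤1 x y with x Fin.≟ y
  ... | yes _  = z≤n
  ... | no  ne = ≤-trans (≤-reflexive (+-identityʳ _)) (codegree≤1 x y ne)

  cod≤d : ∀ x y → cod x y ≤ d
  cod≤d x y = ⊗-bound₁ g g degree≤d (λ _ _ → []≤1 _) x y

  cod-sym : ∀ x y → cod x y ≡ cod y x
  cod-sym x y = Σ-cong n λ z → trans (*-comm (g x z) (g z y))
    (cong₂ (λ p q → [ p ] * [ q ]) (Graph.sym G z y) (Graph.sym G x z))

  cod≤path₂+d : ∀ x y → cod x y ≤ path₂ x y + [ x == y ] * d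
  cod≤path₂+d x y with x Fin.≟ y
  ... | yes _ = ≤-trans (cod≤d x y) (≤-reflexive (≡-sym (+-identityʳ d)))
  ... | no  _ = ≤-reflexive (≡-sym (trans (+-identityʳ _) (+-identityʳ _)))

  cod-rowSum : ∀ x → ΣFin n (cod x) ≤ d * d
  cod-rowSum x = begin
    ΣFin n (λ y → ΣFin n λ z → g x z * g z y) ≡⟨ Σ-swap n n _ ⟩
    ΣFin n (λ z → ΣFin n λ y → g x z * g z y) ≡⟨ Σ-cong n (λ z → Σ-*ˡ n (g x z) (g z)) ⟩
    ΣFin n (λ z → g x z * degree G z)         ≤⟨ Σ-mono n (λ z → *-monoʳ-≤ (g x z) (degree≤d z)) ⟩
    ΣFin n (λ z → g x z * d)                  ≡⟨ Σ-*ʳ n d (g x) ⟩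
    degree G x * d                            ≤⟨ *-monoˡ-≤ d (degree≤d x) ⟩
    d * d                                     ∎
    where open ≤-Reasoning

  -- Each neighbour `z` of `x` other than `y` has at most one common neighbour with `y`, and `z = y`
  -- adds at most `d`.
  path₃≤2d : ∀ x y → (g ⊗ (g ⊗ g)) x y ≤ 2 * d
  path₃≤2d x y = begin
    ΣFin n (λ z → g x z * cod z y)                         ≤⟨ Σ-mono n step ⟩
    ΣFin n (λ z → g x z + [ y == z ] * d)                  ≡⟨ Σ-+ n _ _ ⟩
    degree G x + ΣFin n (λ z → [ y == z ] * d)             ≡⟨ cong (degree G x +_) (Σ-δ n y (λ _ → d)) ⟩
    degree G x + d                                         ≤⟨ +-monoˡ-≤ d (degree≤d x) ⟩
    d + d                                                  ≡⟨ cong (d +_) (+-identityʳ d) ⟨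
    2 * d                                                  ∎
    where
    open ≤-Reasoning
    step : ∀ z → g x z * cod z y ≤ g x z + [ y == z ] * d
    step z with y Fin.≟ z
    ... | yes _  = ≤-trans ([]*≤ (adj G x z) _) (≤-trans (cod≤d z y)
                     (≤-trans (m≤n+m d (g x z)) (≤-reflexive (cong (g x z +_) (≡-sym (+-identityʳ d))))))
    ... | no  ne = ≤-trans (*-monoʳ-≤ (g x z) (codegree≤1 z y (ne ∘ ≡-sym)))
                     (≤-reflexive (trans (*-identityʳ _) (≡-sym (+-identityʳ _))))

  -- The two products differ only at `z = x` and `z = y`, each costing at most `d * cod x y`.
  cod²≤path₂² : ∀ x y → (cod ⊗ cod) x y ≤ (path₂ ⊗ path₂) x y + 2 * d * cod x y
  cod²≤path₂² x y = begin
    ΣFin n (λ z → cod x z * cod z y)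
      ≤⟨ Σ-mono n step ⟩
    ΣFin n (λ z → path₂ x z * path₂ z y + ([ x == z ] * (d * cod z y) + [ y == z ] * (cod x z * d)))
      ≡⟨ trans (Σ-+ n _ _) (cong ((path₂ ⊗ path₂) x y +_) (Σ-+ n _ _)) ⟩
    (path₂ ⊗ path₂) x y + (ΣFin n (λ z → [ x == z ] * (d * cod z y)) + ΣFin n (λ z → [ y == z ] * (cod x z * d)))
      ≡⟨ cong ((path₂ ⊗ path₂) x y +_) (cong₂ _+_ (Σ-δ n x (λ z → d * cod z y)) (Σ-δ n y (λ z → cod x z * d))) ⟩
    (path₂ ⊗ path₂) x y + (d * cod x y + cod x y * d)
      ≡⟨ cong ((path₂ ⊗ path₂) x y +_) (double d (cod x y)) ⟩
    (path₂ ⊗ path₂) x y + 2 * d * cod x y ∎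
    where
    open ≤-Reasoning
    double : ∀ d c → d * c + c * d ≡ 2 * d * c
    double = solve-∀
    expand : ∀ p c δ q ε d → c ≤ p + δ * d → p ≤ c → ∀ c′ → c′ ≤ q + ε * d →
      c * c′ ≤ p * q + (δ * (d * c′) + ε * (c * d))
    expand p c δ q ε d c≤ p≤c c′ c′≤ = begin
      c * c′                                ≤⟨ *-monoˡ-≤ c′ c≤ ⟩
      (p + δ * d) * c′                      ≡⟨ e₁ p δ d c′ ⟩
      p * c′ + δ * (d * c′)                 ≤⟨ +-monoˡ-≤ _ (*-monoʳ-≤ p c′≤) ⟩
      p * (q + ε * d) + δ * (d * c′)        ≡⟨ e₂ p q ε d (δ * (d * c′)) ⟩
      p * q + (δ * (d * c′) + ε * (p * d))  ≤⟨ +-monoʳ-≤ (p * q) (+-monoʳ-≤ (δ * (d * c′)) (*-monoʳ-≤ ε (*-monoˡ-≤ d p≤c))) ⟩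
      p * q + (δ * (d * c′) + ε * (c * d))  ∎
      where
      e₁ : ∀ p δ d c → (p + δ * d) * c ≡ p * c + δ * (d * c)
      e₁ = solve-∀
      e₂ : ∀ p q ε d r → p * (q + ε * d) + r ≡ p * q + (r + ε * (p * d))
      e₂ = solve-∀
    step : ∀ z → cod x z * cod z y ≤
      path₂ x z * path₂ z y + ([ x == z ] * (d * cod z y) + [ y == z ] * (cod x z * d))
    step z = expand (path₂ x z) (cod x z) [ x == z ] (path₂ z y) [ y == z ] d
      (cod≤path₂+d x z) ([]*≤ (x ≠ᵇ z) _) (cod z y)
      (subst (λ b → cod z y ≤ path₂ z y + [ b ] * d) (==-sym z y) (cod≤path₂+d z y))

  -- The correction is `2 d` times the number of 2-walks, which is at most `n d²`. For `d` of order
  -- `√n` it has order `n^(5/2)`, below the error `n³` that `replaceKernel` makes in the same step.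
  tr-cod²≤tr-path₂² : ∀ (K : Mat n) → (∀ x y → K x y ≤ 1) →
    tr (K ⊗ (cod ⊗ cod)) ≤ tr (K ⊗ (path₂ ⊗ path₂)) + 2 * (n * (d * (d * d)))
  tr-cod²≤tr-path₂² K K≤1 = begin
    Σ² n (λ x y → K x y * (cod ⊗ cod) y x)
      ≤⟨ Σ²-mono n step ⟩
    Σ² n (λ x y → K x y * (path₂ ⊗ path₂) y x + 2 * d * cod y x)
      ≡⟨ trans (Σ²-+ n _ _) (cong (tr (K ⊗ (path₂ ⊗ path₂)) +_) (Σ²-*ˡ n (2 * d) _)) ⟩
    tr (K ⊗ (path₂ ⊗ path₂)) + 2 * d * Σ² n (λ x y → cod y x)
      ≡⟨ cong (λ s → tr (K ⊗ (path₂ ⊗ path₂)) + 2 * d * s) (Σ-swap n n _) ⟩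
    tr (K ⊗ (path₂ ⊗ path₂)) + 2 * d * Σ² n cod
      ≤⟨ +-monoʳ-≤ _ (*-monoʳ-≤ (2 * d) (Σ-bound n (d * d) cod-rowSum)) ⟩
    tr (K ⊗ (path₂ ⊗ path₂)) + 2 * d * (n * (d * d))
      ≡⟨ cong (tr (K ⊗ (path₂ ⊗ path₂)) +_) (rearrange d n) ⟩
    tr (K ⊗ (path₂ ⊗ path₂)) + 2 * (n * (d * (d * d))) ∎
    where
    open ≤-Reasoning
    rearrange : ∀ d n → 2 * d * (n * (d * d)) ≡ 2 * (n * (d * (d * d)))
    rearrange = solve-∀
    step : ∀ x y → K x y * (cod ⊗ cod) y x ≤ K x y * (path₂ ⊗ path₂) y x + 2 * d * cod y x
    step x y = begin
      K x y * (cod ⊗ cod) y x                                     ≤⟨ *-monoʳ-≤ (K x y) (cod²≤path₂² y x) ⟩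
      K x y * ((path₂ ⊗ path₂) y x + 2 * d * cod y x)             ≡⟨ *-distribˡ-+ (K x y) _ _ ⟩
      K x y * (path₂ ⊗ path₂) y x + K x y * (2 * d * cod y x)     ≤⟨ +-monoʳ-≤ _ (*-monoˡ-≤ (2 * d * cod y x) (K≤1 x y)) ⟩
      K x y * (path₂ ⊗ path₂) y x + 1 * (2 * d * cod y x)         ≡⟨ cong (K x y * (path₂ ⊗ path₂) y x +_) (*-identityˡ _) ⟩
      K x y * (path₂ ⊗ path₂) y x + 2 * d * cod y x               ∎

  -- Closed walks of length 3 from `x`, that is, twice the number of triangles at `x`.
  triangles : Fin n → ℕ
  triangles x = ΣFin n λ y → g x y * cod y x

  -- An edge lies in at most one triangle, its ends having at most one common neighbour.
  triangles≤d : ∀ x → triangles x ≤ d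
  triangles≤d x = ≤-trans (Σ-mono n step) (degree≤d x)
    where
    step : ∀ y → g x y * cod y x ≤ g x y
    step y with adj G x y in e
    ... | false = z≤n
    ... | true  = ≤-trans (≤-reflexive (*-identityˡ (cod y x))) (codegree≤1 y x (adj⇒≢ G x y e ∘ ≡-sym))

  walk₅ : Fin n → Fin n → Fin n → Fin n → Fin n → ℕ
  walk₅ a b c d e = g a b * (g b c * (g c d * (g d e * g e a)))

  c5 : Fin n → Fin n → Fin n → Fin n → Fin n → ℕ
  c5 a b c d e =
    [ (a ≠ᵇ b) ∧ (a ≠ᵇ c) ∧ (a ≠ᵇ d) ∧ (a ≠ᵇ e) ∧ (b ≠ᵇ c) ∧ (b ≠ᵇ d)
      ∧ (b ≠ᵇ e) ∧ (c ≠ᵇ d) ∧ (c ≠ᵇ e) ∧ (d ≠ᵇ e)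
      ∧ adj G a b ∧ adj G b c ∧ adj G c d ∧ adj G d e ∧ adj G e a ]

  private
    -- The form that `walk₅-cover` takes once all five edges are known to be present: every walk
    -- weight has become 1.
    boolean-cover : ∀ ac ad bd be ce → [ not bd ] * [ not ad ] * 1 ≤
      [ not ac ∧ not ad ∧ not bd ∧ not be ∧ not ce ∧ true ] + ([ ac ] * 1 + [ be ] * 1 + [ ce ] * 1)
    boolean-cover ac    ad    true  be    ce    = z≤n
    boolean-cover ac    true  false be    ce    = z≤n
    boolean-cover true  false false be    ce    = s≤s z≤n
    boolean-cover false false false true  ce    = s≤s z≤n
    boolean-cover false false false false true  = s≤s z≤n
    boolean-cover false false false false false = s≤s z≤n

  -- Consecutive vertices of a walk differ because there are no loops. With `b ≠ d` and `d ≠ a`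
  -- given, only `a = c`, `b = e` or `c = e` can prevent a closed 5-walk from being a 5-cycle.
  walk₅-cover : ∀ a b c d e → [ b ≠ᵇ d ] * [ d ≠ᵇ a ] * walk₅ a b c d e ≤
    c5 a b c d e + ([ a == c ] * walk₅ a b c d e + [ b == e ] * walk₅ a b c d e + [ c == e ] * walk₅ a b c d e)
  walk₅-cover a b c d e rewrite ≠ᵇ-sym d a
    with adj G a b in ab | adj G b c in bc | adj G c d in cd | adj G d e in de | adj G e a in ea
  ... | true | true | true | true | true
    rewrite adj⇒≠ᵇ G a b ab | adj⇒≠ᵇ G b c bc | adj⇒≠ᵇ G c d cd | adj⇒≠ᵇ G d e de
          | ≠ᵇ-sym a e | adj⇒≠ᵇ G e a ea
    = boolean-cover (a == c) (a == d) (b == d) (b == e) (c == e)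
  ... | false | _     | _     | _     | _     = ≤-trans (≤-reflexive (*-zeroʳ ([ b ≠ᵇ d ] * [ a ≠ᵇ d ]))) z≤n
  ... | true  | false | _     | _     | _     = ≤-trans (≤-reflexive (*-zeroʳ ([ b ≠ᵇ d ] * [ a ≠ᵇ d ]))) z≤n
  ... | true  | true  | false | _     | _     = ≤-trans (≤-reflexive (*-zeroʳ ([ b ≠ᵇ d ] * [ a ≠ᵇ d ]))) z≤n
  ... | true  | true  | true  | false | _     = ≤-trans (≤-reflexive (*-zeroʳ ([ b ≠ᵇ d ] * [ a ≠ᵇ d ]))) z≤n
  ... | true  | true  | true  | true  | false = ≤-trans (≤-reflexive (*-zeroʳ ([ b ≠ᵇ d ] * [ a ≠ᵇ d ]))) z≤n


  -- `c` and `e` are the midpoints of the two 2-paths, which meet in `d`.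
  tr-path₂²-expand : tr (g ⊗ (path₂ ⊗ path₂)) ≡
    Σ⁵ n (λ a b c d e → [ b ≠ᵇ d ] * [ d ≠ᵇ a ] * walk₅ a b c d e)
  tr-path₂²-expand = Σ²-cong n λ a b → begin
    g a b * ΣFin n (λ d → path₂ b d * path₂ d a)
      ≡⟨ Σ-*ˡ n (g a b) _ ⟨
    ΣFin n (λ d → g a b * (path₂ b d * path₂ d a))
      ≡⟨ Σ-cong n (λ d → expand (g a b) [ b ≠ᵇ d ] [ d ≠ᵇ a ]
           (λ c → g b c * g c d) (λ e → g d e * g e a)) ⟩
    ΣFin n (λ d → ΣFin n λ c → ΣFin n λ e →
      [ b ≠ᵇ d ] * [ d ≠ᵇ a ] * (g a b * (g b c * g c d * (g d e * g e a))))
      ≡⟨ Σ-swap n n _ ⟩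
    ΣFin n (λ c → ΣFin n λ d → ΣFin n λ e →
      [ b ≠ᵇ d ] * [ d ≠ᵇ a ] * (g a b * (g b c * g c d * (g d e * g e a))))
      ≡⟨ Σ²-cong n (λ c d → Σ-cong n λ e → cong (λ t → [ b ≠ᵇ d ] * [ d ≠ᵇ a ] * (g a b * t)) (*-assoc (g b c) _ _)) ⟩
    ΣFin n (λ c → ΣFin n λ d → ΣFin n λ e → [ b ≠ᵇ d ] * [ d ≠ᵇ a ] * walk₅ a b c d e) ∎
    where
    open ≡-Reasoning
    expand : ∀ t p q (u v : Fin n → ℕ) → t * (p * ΣFin n u * (q * ΣFin n v)) ≡
      ΣFin n (λ c → ΣFin n λ e → p * q * (t * (u c * v e)))
    expand t p q u v = begin
      t * (p * ΣFin n u * (q * ΣFin n v))   ≡⟨ rearrange t p q (ΣFin n u) (ΣFin n v) ⟩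
      p * q * (t * (ΣFin n u * ΣFin n v))   ≡⟨ cong (λ s → p * q * (t * s)) (Σ²-product n u v) ⟨
      p * q * (t * Σ² n (λ c e → u c * v e)) ≡⟨ cong (p * q *_) (Σ²-*ˡ n t _) ⟨
      p * q * Σ² n (λ c e → t * (u c * v e)) ≡⟨ Σ²-*ˡ n (p * q) _ ⟨
      Σ² n (λ c e → p * q * (t * (u c * v e))) ∎
      where
      rearrange : ∀ t p q u v → t * (p * u * (q * v)) ≡ p * q * (t * (u * v))
      rearrange = solve-∀

  private
    edge-sum-bound : ∀ {F : Fin n → Fin n → ℕ} → (∀ a b → F a b ≤ g a b * d) → Σ² n F ≤ n * (d * d)
    edge-sum-bound {F} F≤ = Σ-bound n (d * d) λ a → begin
      ΣFin n (F a)                ≤⟨ Σ-mono n (F≤ a) ⟩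
      ΣFin n (λ b → g a b * d)    ≡⟨ Σ-*ʳ n d (g a) ⟩
      degree G a * d              ≤⟨ *-monoˡ-≤ d (degree≤d a) ⟩
      d * d                       ∎
      where open ≤-Reasoning

  -- In this and the next two bounds the walk consists of a closed walk of length 3 and an edge
  -- traversed back and forth. There are at most `n` starting vertices, with at most `d` choices for
  -- each of the two pieces.
  walks-a≡c : Σ⁵ n (λ a b c d e → [ a == c ] * walk₅ a b c d e) ≤ n * (d * d)
  walks-a≡c = edge-sum-bound λ a b → begin
    ΣFin n (λ c → Σ² n (λ d e → [ a == c ] * walk₅ a b c d e))
      ≡⟨ Σ-cong n (λ c → Σ²-*ˡ n [ a == c ] _) ⟩
    ΣFin n (λ c → [ a == c ] * Σ² n (walk₅ a b c))
      ≡⟨ Σ-δ n a (λ c → Σ² n (walk₅ a b c)) ⟩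
    Σ² n (λ d e → g a b * (g b a * (g a d * (g d e * g e a))))
      ≤⟨ Σ²-mono n (λ d e → *-monoʳ-≤ (g a b) ([]*≤ (adj G b a) _)) ⟩
    Σ² n (λ d e → g a b * (g a d * (g d e * g e a)))
      ≡⟨ trans (Σ²-*ˡ n (g a b) _) (cong (g a b *_) (Σ-cong n λ d → Σ-*ˡ n (g a d) _)) ⟩
    g a b * triangles a
      ≤⟨ *-monoʳ-≤ (g a b) (triangles≤d a) ⟩
    g a b * d ∎
    where open ≤-Reasoning

  walks-b≡e : Σ⁵ n (λ a b c d e → [ b == e ] * walk₅ a b c d e) ≤ n * (d * d)
  walks-b≡e = edge-sum-bound λ a b → begin
    Σ² n (λ c d → ΣFin n λ e → [ b == e ] * walk₅ a b c d e)
      ≡⟨ Σ²-cong n (λ c d → Σ-δ n b (walk₅ a b c d)) ⟩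
    Σ² n (λ c d → g a b * (g b c * (g c d * (g d b * g b a))))
      ≤⟨ Σ²-mono n (λ c d → *-monoʳ-≤ (g a b) (*-monoʳ-≤ (g b c) (*-monoʳ-≤ (g c d)
           (≤-trans (*-monoʳ-≤ (g d b) ([]≤1 (adj G b a))) (≤-reflexive (*-identityʳ _)))))) ⟩
    Σ² n (λ c d → g a b * (g b c * (g c d * g d b)))
      ≡⟨ trans (Σ²-*ˡ n (g a b) _) (cong (g a b *_) (Σ-cong n λ d → Σ-*ˡ n (g b d) _)) ⟩
    g a b * triangles b
      ≤⟨ *-monoʳ-≤ (g a b) (triangles≤d b) ⟩
    g a b * d ∎
    where open ≤-Reasoning

  walks-c≡e : Σ⁵ n (λ a b c d e → [ c == e ] * walk₅ a b c d e) ≤ n * (d * d)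
  walks-c≡e = Σ-bound n (d * d) λ a → begin
    ΣFin n (λ b → ΣFin n λ c → Σ² n (λ d e → [ c == e ] * walk₅ a b c d e))
      ≤⟨ Σ²-mono n (inner a) ⟩
    Σ² n (λ b c → g a b * (g b c * g c a) * d)
      ≡⟨ trans (Σ-cong n λ b → Σ-*ʳ n d _) (Σ-*ʳ n d _) ⟩
    Σ² n (λ b c → g a b * (g b c * g c a)) * d
      ≡⟨ cong (_* d) (Σ-cong n λ b → Σ-*ˡ n (g a b) _) ⟩
    triangles a * d
      ≤⟨ *-monoˡ-≤ d (triangles≤d a) ⟩
    d * d ∎
    where
    open ≤-Reasoning
    rearrange : ∀ p q r s t → p * (q * (r * (s * t))) ≡ p * (q * t) * (r * s)
    rearrange = solve-∀
    inner : ∀ a b c → Σ² n (λ d e → [ c == e ] * walk₅ a b c d e) ≤ g a b * (g b c * g c a) * d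
    inner a b c = begin
      Σ² n (λ d e → [ c == e ] * walk₅ a b c d e)
        ≡⟨ Σ-cong n (λ d → Σ-δ n c (walk₅ a b c d)) ⟩
      ΣFin n (λ d → g a b * (g b c * (g c d * (g d c * g c a))))
        ≡⟨ Σ-cong n (λ d → rearrange (g a b) (g b c) (g c d) (g d c) (g c a)) ⟩
      ΣFin n (λ d → g a b * (g b c * g c a) * (g c d * g d c))
        ≡⟨ Σ-*ˡ n (g a b * (g b c * g c a)) _ ⟩
      g a b * (g b c * g c a) * cod c c
        ≤⟨ *-monoʳ-≤ (g a b * (g b c * g c a)) (cod≤d c c) ⟩
      g a b * (g b c * g c a) * d ∎

  tr-path₂²≤C5 : tr (g ⊗ (path₂ ⊗ path₂)) ≤ labelledC5 G + 3 * (n * (d * d))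
  tr-path₂²≤C5 = begin
    tr (g ⊗ (path₂ ⊗ path₂))
      ≡⟨ tr-path₂²-expand ⟩
    Σ⁵ n (λ a b c d e → [ b ≠ᵇ d ] * [ d ≠ᵇ a ] * walk₅ a b c d e)
      ≤⟨ Σ⁵-mono n walk₅-cover ⟩
    Σ⁵ n (λ a b c d e → c5 a b c d e + (ac a b c d e + be a b c d e + ce a b c d e))
      ≡⟨ trans (Σ⁵-+ n c5 _) (cong (labelledC5 G +_) (trans (Σ⁵-+ n _ ce) (cong (_+ Σ⁵ n ce) (Σ⁵-+ n ac be)))) ⟩
    labelledC5 G + (Σ⁵ n ac + Σ⁵ n be + Σ⁵ n ce)
      ≤⟨ +-monoʳ-≤ (labelledC5 G) (+-mono-≤ (+-mono-≤ walks-a≡c walks-b≡e) walks-c≡e) ⟩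
    labelledC5 G + (n * (d * d) + n * (d * d) + n * (d * d))
      ≡⟨ cong (labelledC5 G +_) (triple (n * (d * d))) ⟩
    labelledC5 G + 3 * (n * (d * d)) ∎
    where
    open ≤-Reasoning
    triple : ∀ t → t + t + t ≡ 3 * t
    triple = solve-∀
    ac be ce : Fin n → Fin n → Fin n → Fin n → Fin n → ℕ
    ac a b c d e = [ a == c ] * walk₅ a b c d e
    be a b c d e = [ b == e ] * walk₅ a b c d e
    ce a b c d e = [ c == e ] * walk₅ a b c d e

  -- The kernels are replaced by M g one at a time, in the order K₃, K₂, K₄, K₁, K₅; this order
  -- keeps the two vectors multiplying the kernel bounded at every step.
  countingLemma : ∀ z M (K₁ K₂ K₃ K₄ K₅ : Mat n) →
    (∀ x y → K₁ x y ≤ 1) → (∀ x y → K₂ x y ≤ 1) → (∀ x y → K₄ x y ≤ 1) → (∀ x y → K₅ x y ≤ 1) →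
    BilinearRegular z M K₁ g → BilinearRegular z M K₂ g → BilinearRegular z M K₃ g →
    BilinearRegular z M K₄ g → BilinearRegular z M K₅ g →
    z * tr₅ K₁ K₂ K₃ K₄ K₅ ≤
      M * (M * (M * (M * (z * M * (labelledC5 G + 3 * (n * (d * d))) + n * n * n
        + z * (2 * (n * (d * (d * d)))))
        + 2 * d * (n * n * n)) + d * d * (n * n * n)) + d * n * (n * n * n)) + n * n * (n * n * n)
  countingLemma z M K₁ K₂ K₃ K₄ K₅ K₁≤1 K₂≤1 K₄≤1 K₅≤1 r₁ r₂ r₃ r₄ r₅ = begin
    z * tr₅ K₁ K₂ K₃ K₄ K₅
      ≡⟨ cong (z *_) (trans (tr₅-rotate K₁ K₂ K₃ K₄ K₅) (tr₅-rotate K₂ K₃ K₄ K₅ K₁)) ⟩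
    z * tr (K₃ ⊗ (K₄ ⊗ (K₅ ⊗ (K₁ ⊗ K₂))))
      ≤⟨ replaceKernel z M K₃ g r₃ K₄ (K₅ ⊗ (K₁ ⊗ K₂)) K₄≤1
           (⊗-bound K₅ (K₁ ⊗ K₂) (rowSum≤n K₅≤1) (⊗-bound₁ K₁ K₂ (rowSum≤n K₁≤1) K₂≤1)) ⟩
    z * M * tr (g ⊗ (K₄ ⊗ (K₅ ⊗ (K₁ ⊗ K₂)))) + 1 * (n * n) * (n * n * n)
      ≤⟨ +-mono-≤ (descend s₂) (≤-reflexive (cong (_* (n * n * n)) (*-identityˡ (n * n)))) ⟩
    M * (M * (M * (M * (z * M * (labelledC5 G + 3 * (n * (d * d))) + n * n * n
        + z * (2 * (n * (d * (d * d)))))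
        + 2 * d * (n * n * n)) + d * d * (n * n * n)) + d * n * (n * n * n)) + n * n * (n * n * n) ∎
    where
    open ≤-Reasoning
    rowSum≤n : ∀ {K : Mat n} → (∀ x y → K x y ≤ 1) → ∀ x → ΣFin n (K x) ≤ n
    rowSum≤n {K} K≤1 x = subst (ΣFin n (K x) ≤_) (*-identityʳ n) (rowSum-bound K K≤1 x)
    descend : ∀ {t u} → z * t ≤ u → z * M * t ≤ M * u
    descend {t} {u} h = ≤-trans (≤-reflexive (shuffle z M t)) (*-monoʳ-≤ M h)
      where
      shuffle : ∀ z M t → z * M * t ≡ M * (z * t)
      shuffle = solve-∀
    -- Multiplied by the powers of `M` collected later, the replacement errors `n³`, `2 d n³`,
    -- `d² n³` and `d n n³` are all of order `n⁵` when `M` and `d` are of order `√n`.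
    t₅ t₄ t₃ t₂ : ℕ
    t₅ = z * M * (labelledC5 G + 3 * (n * (d * d))) + n * n * n + z * (2 * (n * (d * (d * d))))
    t₄ = M * t₅ + 2 * d * (n * n * n)
    t₃ = M * t₄ + d * d * (n * n * n)
    t₂ = M * t₃ + d * n * (n * n * n)
    -- With `cod` as both vectors the error would be `d² n³`; splitting off its diagonal before `K₅`
    -- is replaced reduces it to `n³`.
    s₅ : z * tr (g ⊗ ((g ⊗ (g ⊗ g)) ⊗ K₅)) ≤ t₅
    s₅ = begin
      z * tr (g ⊗ ((g ⊗ (g ⊗ g)) ⊗ K₅))
        ≡⟨ cong (z *_) (trans (tr₅-bracket₃₁ g g g g K₅) (trans (≡-sym (tr₅-rotate K₅ g g g g))
             (≡-sym (tr₅-bracket₂₂ K₅ g g g g)))) ⟩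
      z * tr (K₅ ⊗ (cod ⊗ cod))
        ≤⟨ *-monoʳ-≤ z (tr-cod²≤tr-path₂² K₅ K₅≤1) ⟩
      z * (tr (K₅ ⊗ (path₂ ⊗ path₂)) + 2 * (n * (d * (d * d))))
        ≡⟨ *-distribˡ-+ z (tr (K₅ ⊗ (path₂ ⊗ path₂))) _ ⟩
      z * tr (K₅ ⊗ (path₂ ⊗ path₂)) + z * (2 * (n * (d * (d * d))))
        ≤⟨ +-monoˡ-≤ (z * (2 * (n * (d * (d * d))))) (replaceKernel z M K₅ g r₅ path₂ path₂ path₂≤1 path₂≤1) ⟩
      z * M * tr (g ⊗ (path₂ ⊗ path₂)) + 1 * 1 * (n * n * n) + z * (2 * (n * (d * (d * d))))
        ≤⟨ +-monoˡ-≤ (z * (2 * (n * (d * (d * d))))) (+-mono-≤ (*-monoʳ-≤ (z * M) tr-path₂²≤C5) (≤-reflexive (*-identityˡ (n * n * n)))) ⟩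
      t₅ ∎
    s₄ : z * tr (g ⊗ (K₅ ⊗ (K₁ ⊗ (g ⊗ g)))) ≤ t₄
    s₄ = begin
      z * tr₅ g K₅ K₁ g g
        ≡⟨ cong (z *_) (trans (tr₅-rotate g K₅ K₁ g g) (trans (tr₅-rotate K₅ K₁ g g g)
             (≡-sym (tr₅-bracket₃₁ K₁ g g g K₅)))) ⟩
      z * tr (K₁ ⊗ ((g ⊗ (g ⊗ g)) ⊗ K₅))
        ≤⟨ replaceKernel z M K₁ g r₁ (g ⊗ (g ⊗ g)) K₅ path₃≤2d K₅≤1 ⟩
      z * M * tr (g ⊗ ((g ⊗ (g ⊗ g)) ⊗ K₅)) + 2 * d * 1 * (n * n * n)
        ≤⟨ +-mono-≤ (descend s₅) (≤-reflexive (cong (_* (n * n * n)) (*-identityʳ (2 * d)))) ⟩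
      t₄ ∎
    K₁cod≤d² : ∀ x y → (K₁ ⊗ cod) x y ≤ d * d
    K₁cod≤d² x y = begin
      ΣFin n (λ w → K₁ x w * cod w y)  ≤⟨ Σ-mono n (λ w → *-monoˡ-≤ (cod w y) (K₁≤1 x w)) ⟩
      ΣFin n (λ w → 1 * cod w y)       ≡⟨ Σ-cong n (λ w → trans (*-identityˡ (cod w y)) (cod-sym w y)) ⟩
      ΣFin n (cod y)                   ≤⟨ cod-rowSum y ⟩
      d * d                            ∎
    s₃ : z * tr (g ⊗ ((g ⊗ K₄) ⊗ (K₅ ⊗ K₁))) ≤ t₃
    s₃ = begin
      z * tr (g ⊗ ((g ⊗ K₄) ⊗ (K₅ ⊗ K₁)))
        ≡⟨ cong (z *_) (trans (tr₅-bracket₂₂ g g K₄ K₅ K₁) (trans (tr₅-rotate g g K₄ K₅ K₁)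
             (tr₅-rotate g K₄ K₅ K₁ g))) ⟩
      z * tr (K₄ ⊗ (K₅ ⊗ (K₁ ⊗ (g ⊗ g))))
        ≤⟨ replaceKernel z M K₄ g r₄ K₅ (K₁ ⊗ cod) K₅≤1 K₁cod≤d² ⟩
      z * M * tr (g ⊗ (K₅ ⊗ (K₁ ⊗ (g ⊗ g)))) + 1 * (d * d) * (n * n * n)
        ≤⟨ +-mono-≤ (descend s₄) (≤-reflexive (cong (_* (n * n * n)) (*-identityˡ (d * d)))) ⟩
      t₃ ∎
    s₂ : z * tr (g ⊗ (K₄ ⊗ (K₅ ⊗ (K₁ ⊗ K₂)))) ≤ t₂
    s₂ = begin
      z * tr₅ g K₄ K₅ K₁ K₂
        ≡⟨ cong (z *_) (trans (≡-sym (tr₅-rotate K₂ g K₄ K₅ K₁)) (≡-sym (tr₅-bracket₂₂ K₂ g K₄ K₅ K₁))) ⟩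
      z * tr (K₂ ⊗ ((g ⊗ K₄) ⊗ (K₅ ⊗ K₁)))
        ≤⟨ replaceKernel z M K₂ g r₂ (g ⊗ K₄) (K₅ ⊗ K₁)
             (⊗-bound₁ g K₄ degree≤d K₄≤1) (⊗-bound₁ K₅ K₁ (rowSum≤n K₅≤1) K₁≤1) ⟩
      z * M * tr (g ⊗ ((g ⊗ K₄) ⊗ (K₅ ⊗ K₁))) + d * n * (n * n * n)
        ≤⟨ +-monoˡ-≤ (d * n * (n * n * n)) (descend s₃) ⟩
      t₂ ∎

-- Five-cycles in the complement of a set of pairs.

boolean-union-bound : ∀ v₁ v₂ v₃ v₄ v₅ w₁ w₂ w₃ w₄ w₅ →
  [ v₁ ] * [ v₂ ] * ([ v₃ ] * ([ v₄ ] * [ v₅ ])) ≤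
    [ v₁ ] * [ v₂ ] * [ not w₁ ] * ([ v₂ ] * [ v₃ ] * [ not w₂ ] * ([ v₃ ] * [ v₄ ] * [ not w₃ ] *
      ([ v₄ ] * [ v₅ ] * [ not w₄ ] * ([ v₅ ] * [ v₁ ] * [ not w₅ ]))))
    + ([ v₁ ] * [ v₂ ] * [ w₁ ] * ([ v₃ ] * ([ v₄ ] * [ v₅ ]))
    + ([ v₂ ] * [ v₃ ] * [ w₂ ] * ([ v₄ ] * ([ v₅ ] * [ v₁ ]))
    + ([ v₃ ] * [ v₄ ] * [ w₃ ] * ([ v₅ ] * ([ v₁ ] * [ v₂ ]))
    + ([ v₄ ] * [ v₅ ] * [ w₄ ] * ([ v₁ ] * ([ v₂ ] * [ v₃ ]))
    +  [ v₅ ] * [ v₁ ] * [ w₅ ] * ([ v₂ ] * ([ v₃ ] * [ v₄ ])))))) 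
boolean-union-bound false v₂    v₃    v₄    v₅    _ _ _ _ _ = z≤n
boolean-union-bound true  false v₃    v₄    v₅    _ _ _ _ _ = z≤n
boolean-union-bound true  true  false v₄    v₅    _ _ _ _ _ = z≤n
boolean-union-bound true  true  true  false v₅    _ _ _ _ _ = z≤n
boolean-union-bound true  true  true  true  false _ _ _ _ _ = z≤n
boolean-union-bound true true true true true true  w₂    w₃    w₄    w₅    = s≤s z≤n
boolean-union-bound true true true true true false true  w₃    w₄    w₅    = s≤s z≤n
boolean-union-bound true true true true true false false true  w₄    w₅    = s≤s z≤n
boolean-union-bound true true true true true false false false true  w₅    = s≤s z≤n
boolean-union-bound true true true true true false false false false true  = s≤s z≤n
boolean-union-bound true true true true true false false false false false = s≤s z≤n

count : ∀ {n} → (Fin n → Bool) → ℕ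
count {n} X = ΣFin n λ x → [ X x ]

indicator complement : ∀ {n} → (Fin n → Fin n → Bool) → Mat n
indicator  W x y = [ W x y ]
complement W x y = [ not (W x y) ]

module _ {n} (W : Fin n → Fin n → Bool) where

  private
    missing : (χ χ′ : Fin n → Bool) → ℕ
    missing χ χ′ = Σ² n (restrict (indicator W) χ χ′)

  -- Union bound: each of the five consecutive pairs lies in `W` for at most a tenth of the tuples
  -- in `V₁ × ... × V₅`. Hence at least half of the tuples have all five pairs outside `W`.
  dense-cells⇒many-cycles : ∀ (V₁ V₂ V₃ V₄ V₅ : Fin n → Bool) →
    10 * missing V₁ V₂ ≤ count V₁ * count V₂ → 10 * missing V₂ V₃ ≤ count V₂ * count V₃ →
    10 * missing V₃ V₄ ≤ count V₃ * count V₄ → 10 * missing V₄ V₅ ≤ count V₄ * count V₅ →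
    10 * missing V₅ V₁ ≤ count V₅ * count V₁ →
    count V₁ * count V₂ * (count V₃ * (count V₄ * count V₅)) ≤
    2 * tr₅ (restrict (complement W) V₁ V₂) (restrict (complement W) V₂ V₃) (restrict (complement W) V₃ V₄)
            (restrict (complement W) V₄ V₅) (restrict (complement W) V₅ V₁)
  dense-cells⇒many-cycles V₁ V₂ V₃ V₄ V₅ h₁ h₂ h₃ h₄ h₅ = *-cancelˡ-≤ 5 (+-cancelʳ-≤ (5 * Π) (5 * Π) (5 * (2 * T)) total)
    where
    open ≤-Reasoning
    Π T : ℕ
    Π = count V₁ * count V₂ * (count V₃ * (count V₄ * count V₅))
    T = tr₅ (restrict (complement W) V₁ V₂) (restrict (complement W) V₂ V₃) (restrict (complement W) V₃ V₄)
            (restrict (complement W) V₄ V₅) (restrict (complement W) V₅ V₁)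
    F₁ F₂ F₃ F₄ F₅ : Fin n → Fin n → Fin n → Fin n → Fin n → ℕ
    F₁ a b c d e = restrict (indicator W) V₁ V₂ a b * ([ V₃ c ] * ([ V₄ d ] * [ V₅ e ]))
    F₂ a b c d e = restrict (indicator W) V₂ V₃ b c * ([ V₄ d ] * ([ V₅ e ] * [ V₁ a ]))
    F₃ a b c d e = restrict (indicator W) V₃ V₄ c d * ([ V₅ e ] * ([ V₁ a ] * [ V₂ b ]))
    F₄ a b c d e = restrict (indicator W) V₄ V₅ d e * ([ V₁ a ] * ([ V₂ b ] * [ V₃ c ]))
    F₅ a b c d e = restrict (indicator W) V₅ V₁ e a * ([ V₂ b ] * ([ V₃ c ] * [ V₄ d ]))
    rot : (F : Fin n → Fin n → Fin n → Fin n → Fin n → ℕ) → Fin n → Fin n → Fin n → Fin n → Fin n → ℕ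
    rot F a b c d e = F e a b c d
    factor : ∀ (A B C D E : Fin n → Bool) → Σ⁵ n (λ a b c d e → restrict (indicator W) A B a b * ([ C c ] * ([ D d ] * [ E e ])))
      ≡ missing A B * (count C * (count D * count E))
    factor A B C D E = Σ⁵-factor n (restrict (indicator W) A B) (λ x → [ C x ]) (λ x → [ D x ]) (λ x → [ E x ])
    covered : Π ≤ T + (Σ⁵ n F₁ + (Σ⁵ n F₂ + (Σ⁵ n F₃ + (Σ⁵ n F₄ + Σ⁵ n F₅))))
    covered = begin
      Π ≡⟨ cong (_* (count V₃ * (count V₄ * count V₅))) (Σ²-product n _ _) ⟨
      Σ² n (λ a b → [ V₁ a ] * [ V₂ b ]) * (count V₃ * (count V₄ * count V₅))
        ≡⟨ Σ⁵-factor n (λ a b → [ V₁ a ] * [ V₂ b ]) _ _ _ ⟨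
      Σ⁵ n (λ a b c d e → [ V₁ a ] * [ V₂ b ] * ([ V₃ c ] * ([ V₄ d ] * [ V₅ e ])))
        ≤⟨ Σ⁵-mono n (λ a b c d e → boolean-union-bound (V₁ a) (V₂ b) (V₃ c) (V₄ d) (V₅ e)
             (W a b) (W b c) (W c d) (W d e) (W e a)) ⟩
      Σ⁵ n (λ a b c d e → D a b c d e + (F₁ a b c d e + (F₂ a b c d e + (F₃ a b c d e + (F₄ a b c d e + F₅ a b c d e)))))
        ≡⟨ trans (Σ⁵-+ n D _) (cong (Σ⁵ n D +_) (trans (Σ⁵-+ n F₁ _) (cong (Σ⁵ n F₁ +_)
           (trans (Σ⁵-+ n F₂ _) (cong (Σ⁵ n F₂ +_) (trans (Σ⁵-+ n F₃ _) (cong (Σ⁵ n F₃ +_) (Σ⁵-+ n F₄ F₅)))))))) ⟩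
      Σ⁵ n D + (Σ⁵ n F₁ + (Σ⁵ n F₂ + (Σ⁵ n F₃ + (Σ⁵ n F₄ + Σ⁵ n F₅))))
        ≡⟨ cong (_+ (Σ⁵ n F₁ + (Σ⁵ n F₂ + (Σ⁵ n F₃ + (Σ⁵ n F₄ + Σ⁵ n F₅))))) (tr₅-expand (restrict (complement W) V₁ V₂) (restrict (complement W) V₂ V₃) (restrict (complement W) V₃ V₄)
            (restrict (complement W) V₄ V₅) (restrict (complement W) V₅ V₁)) ⟨
      T + (Σ⁵ n F₁ + (Σ⁵ n F₂ + (Σ⁵ n F₃ + (Σ⁵ n F₄ + Σ⁵ n F₅)))) ∎
      where
      D : Fin n → Fin n → Fin n → Fin n → Fin n → ℕ
      D a b c d e = restrict (complement W) V₁ V₂ a b * (restrict (complement W) V₂ V₃ b c *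
        (restrict (complement W) V₃ V₄ c d * (restrict (complement W) V₄ V₅ d e * restrict (complement W) V₅ V₁ e a)))
    bound : ∀ {S} (A B C D E : Fin n → Bool) → S ≡ missing A B * (count C * (count D * count E)) →
      10 * missing A B ≤ count A * count B → 10 * S ≤ count A * count B * (count C * (count D * count E))
    bound A B C D E refl h = ≤-trans (≤-reflexive (≡-sym (*-assoc 10 (missing A B) _))) (*-monoˡ-≤ (count C * (count D * count E)) h)
    b₁ : 10 * Σ⁵ n F₁ ≤ Π
    b₁ = bound V₁ V₂ V₃ V₄ V₅ (factor V₁ V₂ V₃ V₄ V₅) h₁
    b₂ : 10 * Σ⁵ n F₂ ≤ count V₂ * count V₃ * (count V₄ * (count V₅ * count V₁))
    b₂ = bound V₂ V₃ V₄ V₅ V₁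
           (trans (Σ⁵-rotate n F₂) (factor V₂ V₃ V₄ V₅ V₁)) h₂
    b₃ : 10 * Σ⁵ n F₃ ≤ count V₃ * count V₄ * (count V₅ * (count V₁ * count V₂))
    b₃ = bound V₃ V₄ V₅ V₁ V₂
           (trans (Σ⁵-rotate n F₃) (trans (Σ⁵-rotate n (rot F₃)) (factor V₃ V₄ V₅ V₁ V₂))) h₃
    b₄ : 10 * Σ⁵ n F₄ ≤ count V₄ * count V₅ * (count V₁ * (count V₂ * count V₃))
    b₄ = bound V₄ V₅ V₁ V₂ V₃
           (trans (Σ⁵-rotate n F₄) (trans (Σ⁵-rotate n (rot F₄)) (trans (Σ⁵-rotate n (rot (rot F₄)))
             (factor V₄ V₅ V₁ V₂ V₃)))) h₄
    b₅ : 10 * Σ⁵ n F₅ ≤ count V₅ * count V₁ * (count V₂ * (count V₃ * count V₄))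
    b₅ = bound V₅ V₁ V₂ V₃ V₄
           (trans (Σ⁵-rotate n F₅) (trans (Σ⁵-rotate n (rot F₅)) (trans (Σ⁵-rotate n (rot (rot F₅)))
             (trans (Σ⁵-rotate n (rot (rot (rot F₅)))) (factor V₅ V₁ V₂ V₃ V₄))))) h₅
    distribute : ∀ t f₁ f₂ f₃ f₄ f₅ → 10 * (t + (f₁ + (f₂ + (f₃ + (f₄ + f₅))))) ≡
      10 * t + (10 * f₁ + (10 * f₂ + (10 * f₃ + (10 * f₄ + 10 * f₅))))
    distribute = solve-∀
    collect : ∀ t p q r x y → 10 * t + (p * q * (r * (x * y)) + (q * r * (x * (y * p)) + (r * x * (y * (p * q)) +
      (x * y * (p * (q * r)) + y * p * (q * (r * x)))))) ≡ 5 * (2 * t) + 5 * (p * q * (r * (x * y)))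
    collect = solve-∀
    double : ∀ p → 5 * p + 5 * p ≡ 10 * p
    double = solve-∀
    total : 5 * Π + 5 * Π ≤ 5 * (2 * T) + 5 * Π
    total = begin
      5 * Π + 5 * Π  ≡⟨ double Π ⟩
      10 * Π         ≤⟨ *-monoʳ-≤ 10 covered ⟩
      10 * (T + (Σ⁵ n F₁ + (Σ⁵ n F₂ + (Σ⁵ n F₃ + (Σ⁵ n F₄ + Σ⁵ n F₅)))))
        ≡⟨ distribute T (Σ⁵ n F₁) (Σ⁵ n F₂) (Σ⁵ n F₃) (Σ⁵ n F₄) (Σ⁵ n F₅) ⟩
      10 * T + (10 * Σ⁵ n F₁ + (10 * Σ⁵ n F₂ + (10 * Σ⁵ n F₃ + (10 * Σ⁵ n F₄ + 10 * Σ⁵ n F₅))))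
        ≤⟨ +-monoʳ-≤ (10 * T) (+-mono-≤ b₁ (+-mono-≤ b₂ (+-mono-≤ b₃ (+-mono-≤ b₄ b₅)))) ⟩
      10 * T + (Π + (count V₂ * count V₃ * (count V₄ * (count V₅ * count V₁)) + (count V₃ * count V₄ * (count V₅ * (count V₁ * count V₂))
        + (count V₄ * count V₅ * (count V₁ * (count V₂ * count V₃)) + count V₅ * count V₁ * (count V₂ * (count V₃ * count V₄))))))
        ≡⟨ collect T (count V₁) (count V₂) (count V₃) (count V₄) (count V₅) ⟩
      5 * (2 * T) + 5 * Π ∎

-- Edge bounds in graphs without 4-cycles

degreeInto : ∀ {n} → Graph n → (Fin n → Bool) → Fin n → ℕ
degreeInto {n} G X y = ΣFin n λ x → [ X x ] * edge G x y

crossing : ∀ {n} → Graph n → (X Y : Fin n → Bool) → ℕ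
crossing {n} G X Y = ΣFin n λ y → [ Y y ] * degreeInto G X y

-- Double count of triples `(x, x′, y)` with `y` adjacent to both. For `x ≠ x′` there is at most one
-- such `y`, and the triples with `x = x′` are the crossing edges.
kővári-sós-turán : ∀ {n} (G : Graph n) → CodegreeAtMostOne G → ∀ (X Y : Fin n → Bool) →
  ΣFin n (λ y → [ Y y ] * (degreeInto G X y * degreeInto G X y)) ≤ count X * count X + crossing G X Y
kővári-sós-turán {n} G codegree≤1 X Y = begin
  ΣFin n (λ y → [ Y y ] * (degreeInto G X y * degreeInto G X y))
    ≡⟨ Σ-cong n (λ y → trans (cong ([ Y y ] *_) (≡-sym (Σ²-product n (λ x → w x y) (λ x → w x y)))) (≡-sym (Σ²-*ˡ n [ Y y ] _))) ⟩
  ΣFin n (λ y → Σ² n λ x x′ → [ Y y ] * (w x y * w x′ y))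
    ≡⟨ trans (Σ-swap n n _) (Σ-cong n λ x → Σ-swap n n _) ⟩
  Σ² n (λ x x′ → ΣFin n λ y → [ Y y ] * (w x y * w x′ y))
    ≤⟨ Σ²-mono n pair ⟩
  Σ² n (λ x x′ → [ X x ] * [ X x′ ] + [ x == x′ ] * ΣFin n λ y → [ Y y ] * w x y)
    ≡⟨ trans (Σ²-+ n _ _) (cong₂ _+_ (Σ²-product n _ _) (Σ-cong n λ x → Σ-δ n x _)) ⟩
  count X * count X + Σ² n (λ x y → [ Y y ] * w x y)
    ≡⟨ cong (count X * count X +_) (trans (Σ-swap n n _) (Σ-cong n λ y → Σ-*ˡ n [ Y y ] _)) ⟩
  count X * count X + crossing G X Y ∎
  where
  open ≤-Reasoning
  w : Fin n → Fin n → ℕ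
  w x y = [ X x ] * edge G x y
  pair : ∀ x x′ → ΣFin n (λ y → [ Y y ] * (w x y * w x′ y)) ≤
    [ X x ] * [ X x′ ] + [ x == x′ ] * ΣFin n λ y → [ Y y ] * w x y
  pair x x′ with x Fin.≟ x′
  ... | yes refl = ≤-trans
    (Σ-mono n λ y → *-monoʳ-≤ [ Y y ] (≤-reflexive (square (X x) (adj G x y))))
    (≤-trans (≤-reflexive (≡-sym (+-identityʳ _))) (m≤n+m _ ([ X x ] * [ X x ])))
    where
    square : ∀ a b → [ a ] * [ b ] * ([ a ] * [ b ]) ≡ [ a ] * [ b ]
    square true  true  = refl
    square true  false = refl
    square false b     = refl
  ... | no x≢x′ = ≤-trans (begin
    ΣFin n (λ y → [ Y y ] * (w x y * w x′ y))
      ≤⟨ Σ-mono n (λ y → []*≤ (Y y) _) ⟩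
    ΣFin n (λ y → w x y * w x′ y)
      ≡⟨ Σ-cong n (λ y → trans (rearrange [ X x ] (edge G x y) [ X x′ ] (edge G x′ y))
           (cong (λ b → [ X x ] * [ X x′ ] * (edge G x y * [ b ])) (Graph.sym G x′ y))) ⟩
    ΣFin n (λ y → [ X x ] * [ X x′ ] * (edge G x y * edge G y x′))
      ≡⟨ Σ-*ˡ n ([ X x ] * [ X x′ ]) _ ⟩
    [ X x ] * [ X x′ ] * (edge G ⊗ edge G) x x′
      ≤⟨ *-monoʳ-≤ ([ X x ] * [ X x′ ]) (codegree≤1 x x′ x≢x′) ⟩
    [ X x ] * [ X x′ ] * 1
      ≡⟨ *-identityʳ _ ⟩
    [ X x ] * [ X x′ ] ∎) (m≤m+n _ 0)
    where
    rearrange : ∀ p q r t → p * q * (r * t) ≡ p * r * (q * t)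
    rearrange = solve-∀

am-gm : ∀ u v → 2 * (u * v) ≤ u * u + v * v
am-gm u v with ≤-total u v
... | inj₁ u≤v = subst (λ v → 2 * (u * v) ≤ u * u + v * v) (m+[n∸m]≡n u≤v)
                   (≤-trans (m≤m+n _ ((v ∸ u) * (v ∸ u))) (≤-reflexive (expand u (v ∸ u))))
  where
  expand : ∀ u t → 2 * (u * (u + t)) + t * t ≡ u * u + (u + t) * (u + t)
  expand = solve-∀
... | inj₂ v≤u = subst (λ u → 2 * (u * v) ≤ u * u + v * v) (m+[n∸m]≡n v≤u)
                   (≤-trans (m≤m+n _ ((u ∸ v) * (u ∸ v))) (≤-reflexive (expand v (u ∸ v))))
  where
  expand : ∀ v t → 2 * ((v + t) * v) + t * t ≡ (v + t) * (v + t) + v * v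
  expand = solve-∀

crossing≤ : ∀ {n} (G : Graph n) {d} → (∀ x → degree G x ≤ d) → ∀ X Y → crossing G X Y ≤ count X * d
crossing≤ {n} G {d} degree≤d X Y = begin
  ΣFin n (λ y → [ Y y ] * degreeInto G X y)              ≤⟨ Σ-mono n (λ y → []*≤ (Y y) _) ⟩
  ΣFin n (λ y → ΣFin n λ x → [ X x ] * edge G x y)       ≡⟨ Σ-swap n n _ ⟩
  ΣFin n (λ x → ΣFin n λ y → [ X x ] * edge G x y)       ≡⟨ Σ-cong n (λ x → Σ-*ˡ n [ X x ] _) ⟩
  ΣFin n (λ x → [ X x ] * degree G x)                    ≤⟨ Σ-mono n (λ x → *-monoʳ-≤ [ X x ] (degree≤d x)) ⟩
  ΣFin n (λ x → [ X x ] * d)                             ≡⟨ Σ-*ʳ n d _ ⟩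
  count X * d                                            ∎
  where open ≤-Reasoning

-- A weighted AM-GM inequality for `s * δ y` and `w * count X`, with free weights `s` and `w`,
-- replaces Cauchy-Schwarz; then `kővári-sós-turán` bounds the squares. At the end `count X` is
-- divided out, so an empty `X` is treated apart.
crossing-bound : ∀ {n} (G : Graph n) {d} → CodegreeAtMostOne G → (∀ x → degree G x ≤ d) → ∀ s w X Y →
  2 * (s * w) * crossing G X Y ≤ s * s * count X + s * s * d + w * w * (count X * count Y)
crossing-bound {n} G {d} codegree≤1 degree≤d s w X Y = divide (count X ≟ 0)
  where
  open ≤-Reasoning
  e c : ℕ
  e = crossing G X Y
  c = count X
  δ : Fin n → ℕ
  δ = degreeInto G X
  scaled : 2 * (s * w) * (c * e) ≤ s * s * (c * c + e) + w * w * (c * c) * count Y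
  scaled = begin
    2 * (s * w) * (c * e)
      ≡⟨ trans (≡-sym (*-assoc (2 * (s * w)) c e)) (≡-sym (Σ-*ˡ n (2 * (s * w) * c) _)) ⟩
    ΣFin n (λ y → 2 * (s * w) * c * ([ Y y ] * δ y))
      ≤⟨ Σ-mono n (λ y → ≤-trans (≤-reflexive (e₁ s w c [ Y y ] (δ y)))
           (≤-trans (*-monoʳ-≤ [ Y y ] (am-gm (s * δ y) (w * c))) (≤-reflexive (e₂ s w c [ Y y ] (δ y))))) ⟩
    ΣFin n (λ y → s * s * ([ Y y ] * (δ y * δ y)) + w * w * (c * c) * [ Y y ])
      ≡⟨ trans (Σ-+ n _ _) (cong₂ _+_ (Σ-*ˡ n (s * s) _) (Σ-*ˡ n (w * w * (c * c)) _)) ⟩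
    s * s * ΣFin n (λ y → [ Y y ] * (δ y * δ y)) + w * w * (c * c) * count Y
      ≤⟨ +-monoˡ-≤ _ (*-monoʳ-≤ (s * s) (kővári-sós-turán G codegree≤1 X Y)) ⟩
    s * s * (c * c + e) + w * w * (c * c) * count Y ∎
    where
    e₁ : ∀ s w c y δ → 2 * (s * w) * c * (y * δ) ≡ y * (2 * (s * δ * (w * c)))
    e₁ = solve-∀
    e₂ : ∀ s w c y δ → y * (s * δ * (s * δ) + w * c * (w * c)) ≡ s * s * (y * (δ * δ)) + w * w * (c * c) * y
    e₂ = solve-∀
  divide : Dec (c ≡ 0) → 2 * (s * w) * e ≤ s * s * c + s * s * d + w * w * (c * count Y)
  divide (yes c≡0) = ≤-trans (≤-reflexive (trans (cong (2 * (s * w) *_) e≡0) (*-zeroʳ (2 * (s * w))))) z≤n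
    where
    e≡0 : e ≡ 0
    e≡0 = n≤0⇒n≡0 (subst (λ c → e ≤ c * d) c≡0 (crossing≤ G degree≤d X Y))
  divide (no c≢0) = *-cancelˡ-≤ c {{≢-nonZero c≢0}} (begin
    c * (2 * (s * w) * e)                                       ≡⟨ swap c (2 * (s * w)) e ⟩
    2 * (s * w) * (c * e)                                       ≤⟨ scaled ⟩
    s * s * (c * c + e) + w * w * (c * c) * count Y
      ≤⟨ +-monoˡ-≤ _ (*-monoʳ-≤ (s * s) (+-monoʳ-≤ (c * c) (crossing≤ G degree≤d X Y))) ⟩
    s * s * (c * c + c * d) + w * w * (c * c) * count Y         ≡⟨ pull s w c d (count Y) ⟩
    c * (s * s * c + s * s * d + w * w * (c * count Y))         ∎)
    where
    swap : ∀ m a e → m * (a * e) ≡ a * (m * e)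
    swap = solve-∀
    pull : ∀ s w m d y → s * s * (m * m + m * d) + w * w * (m * m) * y ≡ m * (s * s * m + s * s * d + w * w * (m * y))
    pull = solve-∀

⌊⌋-yes : ∀ {P : Set} (P? : Dec P) → P → ⌊ P? ⌋ ≡ true
⌊⌋-yes (yes _) p = refl
⌊⌋-yes (no ¬p) p = contradiction p ¬p

⌊⌋-no⁻¹ : ∀ {P : Set} (P? : Dec P) → ⌊ P? ⌋ ≡ false → ¬ P
⌊⌋-no⁻¹ (no ¬p) _ = ¬p

-- Deleting edges

-- `ok` may be asymmetric: an edge is kept only if both of its orientations are ok.
prune : ∀ {n} → Graph n → (Fin n → Fin n → Bool) → Graph n
prune G ok .adj x y = adj G x y ∧ (ok x y ∧ ok y x)
prune G ok .Graph.sym x y = cong₂ _∧_ (Graph.sym G x y) (∧-comm (ok x y) (ok y x))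
prune G ok .irref x rewrite irref G x = refl

prune-adj : ∀ {n} (G : Graph n) ok x y → adj (prune G ok) x y ≡ true → adj G x y ≡ true × ok x y ≡ true
prune-adj G ok x y e with ∧-true (adj G x y) _ e
... | g , oks = g , proj₁ (∧-true (ok x y) (ok y x) oks)

prune-⊆ : ∀ {n} (G : Graph n) ok → prune G ok ⊆G G
prune-⊆ G ok x y e = proj₁ (prune-adj G ok x y e)

-- Counts ordered pairs, so an edge with both orientations in `B` counts twice.
removed : ∀ {n} → Graph n → (Fin n → Fin n → Bool) → ℕ
removed {n} G B = Σ² n λ x y → [ B x y ] * edge G x y

-- A deleted edge `x < y` has `ok x y` or `ok y x` false. Each case is bounded by the sum over all
-- ordered pairs, whence the factor 2.
edges-prune : ∀ {n} (G : Graph n) ok →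
  edges G ≤ edges (prune G ok) + 2 * removed G (λ x y → not (ok x y))
edges-prune {n} G ok = begin
  edges G
    ≤⟨ Σ²-mono n (λ x y → cases ⌊ x Fin.<? y ⌋ (ok x y) (ok y x) (Graph.sym G x y)) ⟩
  Σ² n (λ x y → [ ⌊ x Fin.<? y ⌋ ∧ adj (prune G ok) x y ] + (B x y + B y x))
    ≡⟨ trans (Σ²-+ n _ _) (cong (edges (prune G ok) +_) (trans (Σ²-+ n B (λ x y → B y x))
         (cong (Σ² n B +_) (trans (Σ-swap n n _) (≡-sym (+-identityʳ (Σ² n B))))))) ⟩
  edges (prune G ok) + 2 * removed G (λ x y → not (ok x y)) ∎
  where
  open ≤-Reasoning
  B : Fin n → Fin n → ℕ
  B x y = [ not (ok x y) ] * edge G x y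
  cases : ∀ l {a a′} p q → a ≡ a′ → [ l ∧ a ] ≤ [ l ∧ (a ∧ (p ∧ q)) ] + ([ not p ] * [ a ] + [ not q ] * [ a′ ])
  cases false         p     q     refl = z≤n
  cases true  {false} p     q     refl = z≤n
  cases true  {true}  true  true  refl = s≤s z≤n
  cases true  {true}  true  false refl = s≤s z≤n
  cases true  {true}  false q     refl = s≤s z≤n

⊆G⇒edge≤ : ∀ {n} {H G : Graph n} → H ⊆G G → ∀ x y → edge H x y ≤ edge G x y
⊆G⇒edge≤ {H = H} {G} H⊆G x y with adj H x y in e
... | false = z≤n
... | true  rewrite H⊆G x y e = ≤-refl

⊆G⇒codegree : ∀ {n} {H G : Graph n} → H ⊆G G → CodegreeAtMostOne G → CodegreeAtMostOne H
⊆G⇒codegree {n} {H} {G} H⊆G codegree≤1 x y x≢y = ≤-trans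
  (Σ-mono n λ z → *-mono-≤ (⊆G⇒edge≤ {H = H} {G} H⊆G x z) (⊆G⇒edge≤ {H = H} {G} H⊆G z y)) (codegree≤1 x y x≢y)

∧-monoʳ : ∀ a {b c} → [ b ] ≤ [ c ] → [ a ∧ b ] ≤ [ a ∧ c ]
∧-monoʳ true  h = h
∧-monoʳ false h = z≤n

[∧]-mono : ∀ {a a′ b b′} → [ a ] ≤ [ a′ ] → [ b ] ≤ [ b′ ] → [ a ∧ b ] ≤ [ a′ ∧ b′ ]
[∧]-mono {true}  {true} h h′ = h′
[∧]-mono {false}        h h′ = z≤n

⊆G⇒labelledC5≤ : ∀ {n} {H G : Graph n} → H ⊆G G → labelledC5 H ≤ labelledC5 G
⊆G⇒labelledC5≤ {n} {H} {G} H⊆G = Σ⁵-mono n λ a b c d e →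
  ∧-monoʳ (a ≠ᵇ b) $ ∧-monoʳ (a ≠ᵇ c) $ ∧-monoʳ (a ≠ᵇ d) $ ∧-monoʳ (a ≠ᵇ e) $ ∧-monoʳ (b ≠ᵇ c) $
  ∧-monoʳ (b ≠ᵇ d) $ ∧-monoʳ (b ≠ᵇ e) $ ∧-monoʳ (c ≠ᵇ d) $ ∧-monoʳ (c ≠ᵇ e) $ ∧-monoʳ (d ≠ᵇ e) $
  [∧]-mono {adj H a b} (≤ₑ a b) $ [∧]-mono {adj H b c} (≤ₑ b c) $
  [∧]-mono {adj H c d} (≤ₑ c d) $ [∧]-mono {adj H d e} (≤ₑ d e) (≤ₑ e a)
  where
  ≤ₑ : ∀ x y → edge H x y ≤ edge G x y
  ≤ₑ = ⊆G⇒edge≤ {H = H} {G} H⊆G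

-- Cycles read off from the labelled counts.

record FiveCycle {n} (G : Graph n) : Set where
  field
    a b c d e : Fin n
    ab : adj G a b ≡ true
    bc : adj G b c ≡ true
    cd : adj G c d ≡ true
    de : adj G d e ≡ true
    ea : adj G e a ≡ true

-- Only the five adjacencies are extracted; they serve to find five cells joined by surviving edges.
labelledC5≢0⇒fiveCycle : ∀ {n} (G : Graph n) → labelledC5 G ≢ 0 → FiveCycle G
labelledC5≢0⇒fiveCycle {n} G ne
  with a , ne₁ ← Σ-nonzero n _ ne
  with b , ne₂ ← Σ-nonzero n _ ne₁
  with c , ne₃ ← Σ-nonzero n _ ne₂
  with d , ne₄ ← Σ-nonzero n _ ne₃
  with e , ne₅ ← Σ-nonzero n _ ne₄ =
  record { a = a ; b = b ; c = c ; d = d ; e = e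
         ; ab = ∧ˡ (adj G a b) t ; bc = ∧ˡ (adj G b c) t₁ ; cd = ∧ˡ (adj G c d) t₂
         ; de = ∧ˡ (adj G d e) t₃ ; ea = ∧ʳ (adj G d e) t₃ }
  where
  ∧ˡ : ∀ p {q} → p ∧ q ≡ true → p ≡ true
  ∧ˡ p h = proj₁ (∧-true p _ h)
  ∧ʳ : ∀ p {q} → p ∧ q ≡ true → q ≡ true
  ∧ʳ p h = proj₂ (∧-true p _ h)
  t = ∧ʳ (d ≠ᵇ e) $ ∧ʳ (c ≠ᵇ e) $ ∧ʳ (c ≠ᵇ d) $ ∧ʳ (b ≠ᵇ e) $ ∧ʳ (b ≠ᵇ d) $
      ∧ʳ (b ≠ᵇ c) $ ∧ʳ (a ≠ᵇ e) $ ∧ʳ (a ≠ᵇ d) $ ∧ʳ (a ≠ᵇ c) $ ∧ʳ (a ≠ᵇ b) $ []≢0 _ ne₅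
  t₁ = ∧ʳ (adj G a b) t
  t₂ = ∧ʳ (adj G b c) t₁
  t₃ = ∧ʳ (adj G c d) t₂

-- Two common neighbours `z ≠ z′` of `x` and `y` would make `x z y z′` a 4-cycle, a nonzero summand
-- of `labelledC4`.
C4-free⇒codegree : ∀ {n} (G : Graph n) → C4-free G → CodegreeAtMostOne G
C4-free⇒codegree {n} G c4 x y x≢y =
  Σ-at-most-one n _ (λ z → ≤-trans ([]*≤ (adj G x z) _) ([]≤1 (adj G z y))) disjoint
  where
  no-C4 : ∀ a b c d → _ ≡ 0
  no-C4 a b c d = Σ-zero⁻¹ n _ (Σ-zero⁻¹ n _ (Σ-zero⁻¹ n _ (Σ-zero⁻¹ n _ c4 a) b) c) d
  disjoint : ∀ z z′ → z ≢ z′ → edge G x z * edge G z y * (edge G x z′ * edge G z′ y) ≡ 0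
  disjoint z z′ z≢z′ with adj G x z in xz | adj G z y in zy | adj G x z′ in xz′ | adj G z′ y in z′y
  ... | false | _     | _     | _     = refl
  ... | true  | false | _     | _     = refl
  ... | true  | true  | false | _     = refl
  ... | true  | true  | true  | false = refl
  ... | true  | true  | true  | true  = subst (λ b → [ b ] ≡ 0) all-true (no-C4 x z y z′)
    where
    yz′ : adj G y z′ ≡ true
    yz′ = trans (Graph.sym G y z′) z′y
    z′x : adj G z′ x ≡ true
    z′x = trans (Graph.sym G z′ x) xz′
    all-true : ((x ≠ᵇ z) ∧ (x ≠ᵇ y) ∧ (x ≠ᵇ z′) ∧ (z ≠ᵇ y) ∧ (z ≠ᵇ z′) ∧ (y ≠ᵇ z′)
      ∧ adj G x z ∧ adj G z y ∧ adj G y z′ ∧ adj G z′ x) ≡ true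
    all-true rewrite adj⇒≠ᵇ G x z xz | ≢⇒≠ᵇ x y x≢y | adj⇒≠ᵇ G x z′ xz′ | adj⇒≠ᵇ G z y zy
      | ≢⇒≠ᵇ z z′ z≢z′ | adj⇒≠ᵇ G y z′ yz′ | xz | zy | yz′ | z′x = refl

-- Trimming the vertices of large degree.

module Trim {n} (G : Graph n) (codegree≤1 : CodegreeAtMostOne G) (d : ℕ) where

  high : Fin n → Bool
  high x = ⌊ d <? degree G x ⌋

  trimmed : Graph n
  trimmed = prune G (λ x _ → not (high x))

  trimmed-degree : ∀ x → degree trimmed x ≤ d
  trimmed-degree x = go (d <? degree G x)
    where
    go : Dec (d < degree G x) → degree trimmed x ≤ d
    go (no  d≮) = ≤-trans (Σ-mono n (⊆G⇒edge≤ {H = trimmed} {G} (prune-⊆ G (λ x _ → not (high x))) x)) (≮⇒≥ d≮)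
    go (yes d<) = ≤-trans (≤-reflexive (Σ-zero n λ y → cong [_] (trans
      (cong (λ b → adj G x y ∧ (not b ∧ not (high y))) (⌊⌋-yes (d <? degree G x) d<)) (∧-zeroʳ (adj G x y))))) z≤n

  -- For a high vertex `(d + 1) δ ≤ δ²`, and `kővári-sós-turán` bounds the sum of the squares by
  -- `n² + S`. The extra 1 from the strict inequality cancels `S`.
  trimmed-removed : d * removed G (λ x _ → high x) ≤ n * n
  trimmed-removed = +-cancelˡ-≤ S _ _ (begin
    S + d * removed G (λ x _ → high x)
      ≡⟨ cong (λ t → S + d * t) (Σ-cong n λ x → trans (Σ-*ˡ n [ high x ] _) (cong ([ high x ] *_) (degree≡ x))) ⟩
    suc d * S
      ≡⟨ Σ-*ˡ n (suc d) _ ⟨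
    ΣFin n (λ x → suc d * ([ high x ] * δ x))
      ≤⟨ Σ-mono n large ⟩
    ΣFin n (λ x → [ high x ] * (δ x * δ x))
      ≤⟨ kővári-sós-turán G codegree≤1 (λ _ → true) high ⟩
    count {n} (λ _ → true) * count {n} (λ _ → true) + S
      ≡⟨ trans (cong₂ (λ p q → p * q + S) n≡ n≡) (+-comm (n * n) S) ⟩
    S + n * n ∎)
    where
    open ≤-Reasoning
    δ : Fin n → ℕ
    δ = degreeInto G (λ _ → true)
    S : ℕ
    S = crossing G (λ _ → true) high
    n≡ : count {n} (λ _ → true) ≡ n
    n≡ = trans (Σ-const n 1) (*-identityʳ n)
    degree≡ : ∀ x → degree G x ≡ δ x
    degree≡ x = Σ-cong n λ y → trans (cong [_] (Graph.sym G x y)) (≡-sym (+-identityʳ _))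
    large : ∀ x → suc d * ([ high x ] * δ x) ≤ [ high x ] * (δ x * δ x)
    large x with d <? degree G x
    ... | no  _  = ≤-reflexive (*-zeroʳ (suc d))
    ... | yes d< rewrite +-identityʳ (δ x) | +-identityʳ (δ x * δ x) =
      *-monoˡ-≤ (δ x) (subst (d <_) (degree≡ x) d<)

-- The arithmetic of the counting lemma with M = d = h s and n ≈ s²

cycles-from-counting : ∀ h s n z k L T → 1 ≤ s → s * s ≤ n →
  5 * z * (h * h * h * h * h * h * h) ≤ s →
  z ≡ 2 * (k * k * k * k * k) * (3 + h * h + 4 * (h * h * h * h)) →
  n * n * (n * n * n) ≤ k * k * k * k * k * (2 * T) →
  z * T ≤ (h * s) * ((h * s) * ((h * s) * ((h * s) * (z * (h * s) * (L + 3 * (n * (h * s * (h * s)))) + n * n * n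
        + z * (2 * (n * (h * s * (h * s * (h * s))))))
        + 2 * (h * s) * (n * n * n)) + h * s * (h * s) * (n * n * n)) + h * s * n * (n * n * n)) + n * n * (n * n * n) →
  s * (n * n) ≤ z * (h * h * h * h * h) * L
cycles-from-counting h s@(suc _) n z k L T 1≤s s²≤n z≤ z≡ n⁵≤ zT≤ = *-cancelˡ-≤ (s * s * s * s * s) (begin
  s * s * s * s * s * (s * (n * n))        ≡⟨ e₁ s n ⟩
  n * n * (s * s * (s * s) * (s * s))      ≤⟨ *-monoʳ-≤ (n * n) (*-mono-≤ (*-mono-≤ s²≤n s²≤n) s²≤n) ⟩
  n * n * (n * n * n)                      ≤⟨ +-cancelʳ-≤ (A * N) N (z * H₅ * S₅ * L) main ⟩
  z * H₅ * S₅ * L                          ≡⟨ e₂ z H₅ S₅ L ⟩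
  s * s * s * s * s * (z * H₅ * L)         ∎)
  where
  open ≤-Reasoning
  A N H₅ S₅ : ℕ
  -- `A` adds up the coefficients of `n⁵` in all error terms, and `z = 2 k⁵ (1 + A)`. Of the `1 + A`
  -- copies of `n⁵` below `z T`, one therefore survives the errors.
  A = 2 + h * h + 4 * (h * h * h * h)
  N = n * n * (n * n * n)
  H₅ = h * h * h * h * h
  S₅ = s * s * s * s * s
  e₁ : ∀ s n → s * s * s * s * s * (s * (n * n)) ≡ n * n * (s * s * (s * s) * (s * s))
  e₁ = solve-∀
  e₂ : ∀ z H S L → z * H * S * L ≡ S * (z * H * L)
  e₂ = solve-∀
  expand : ∀ h s n z L → (h * s) * ((h * s) * ((h * s) * ((h * s) * (z * (h * s) * (L + 3 * (n * (h * s * (h * s)))) + n * n * n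
        + z * (2 * (n * (h * s * (h * s * (h * s))))))
        + 2 * (h * s) * (n * n * n)) + h * s * (h * s) * (n * n * n)) + h * s * n * (n * n * n)) + n * n * (n * n * n)
    ≡ z * (h * h * h * h * h) * (s * s * s * s * s) * L
      + (5 * z * (h * h * h * h * h * h * h) * (s * (s * s) * (s * s) * (s * s) * n)
      + 4 * (h * h * h * h) * (s * s * (s * s) * (n * n * n))
      + h * h * (s * s * (n * n * n * n)) + n * n * (n * n * n))
  expand = solve-∀
  collect : ∀ h n → n * n * n * n * n + 4 * (h * h * h * h) * (n * n * (n * n * n))
      + h * h * (n * (n * n * n * n)) + n * n * (n * n * n) ≡ (2 + h * h + 4 * (h * h * h * h)) * (n * n * (n * n * n))
  collect = solve-∀
  shift : ∀ s n → s * (s * (s * s) * (s * s) * (s * s) * n) ≡ s * s * (s * s) * (s * s) * (s * s) * n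
  shift = solve-∀
  assoc : ∀ k A T → (1 + A) * (k * k * k * k * k * (2 * T)) ≡ 2 * (k * k * k * k * k) * (1 + A) * T
  assoc = solve-∀
  -- The degenerate walks: 3 from `3 n d²` and 2 from `2 n d³`, in total `5 z h⁷ s⁷ n`. The assumed
  -- lower bound on `s` absorbs the constant.
  s⁸n≤ : 5 * z * (h * h * h * h * h * h * h) * (s * (s * s) * (s * s) * (s * s) * n) ≤ n * n * n * n * n
  s⁸n≤ = begin
    5 * z * (h * h * h * h * h * h * h) * (s * (s * s) * (s * s) * (s * s) * n) ≤⟨ *-monoˡ-≤ _ z≤ ⟩
    s * (s * (s * s) * (s * s) * (s * s) * n)     ≡⟨ shift s n ⟩
    s * s * (s * s) * (s * s) * (s * s) * n       ≤⟨ *-monoˡ-≤ n (*-mono-≤ (*-mono-≤ (*-mono-≤ s²≤n s²≤n) s²≤n) s²≤n) ⟩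
    n * n * n * n * n                             ∎
  main : N + A * N ≤ z * H₅ * S₅ * L + A * N
  main = begin
    N + A * N                                   ≤⟨ *-monoʳ-≤ (1 + A) n⁵≤ ⟩
    (1 + A) * (k * k * k * k * k * (2 * T))     ≡⟨ trans (assoc k A T) (cong (_* T) (≡-sym z≡)) ⟩
    z * T                                       ≤⟨ zT≤ ⟩
    _                                           ≡⟨ expand h s n z L ⟩
    z * H₅ * S₅ * L
      + (5 * z * (h * h * h * h * h * h * h) * (s * (s * s) * (s * s) * (s * s) * n)
      + 4 * (h * h * h * h) * (s * s * (s * s) * (n * n * n))
      + h * h * (s * s * (n * n * n * n)) + n * n * (n * n * n))
      ≤⟨ +-monoʳ-≤ (z * H₅ * S₅ * L) (+-monoˡ-≤ N (+-mono-≤ (+-mono-≤ s⁸n≤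
           (*-monoʳ-≤ (4 * (h * h * h * h)) (*-monoˡ-≤ (n * n * n) (*-mono-≤ s²≤n s²≤n))))
           (*-monoʳ-≤ (h * h) (*-monoˡ-≤ (n * n * n * n) s²≤n)))) ⟩
    z * H₅ * S₅ * L + (n * n * n * n * n + 4 * (h * h * h * h) * (n * n * (n * n * n))
      + h * h * (n * (n * n * n * n)) + n * n * (n * n * n))
      ≡⟨ cong (z * H₅ * S₅ * L +_) (collect h n) ⟩
    z * H₅ * S₅ * L + A * N ∎

-- One step of the removal argument

-- s stands for √n and 1/Q for ε; the degree bound 32 Q s also serves as the density parameter M.
record Setting (Q n s : ℕ) (G : Graph n) : Set where
  field
    1≤s        : 1 ≤ s
    s²≤n       : s * s ≤ n
    n≤4s²      : n ≤ 4 * (s * s)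
    codegree≤1 : CodegreeAtMostOne G
    degree≤    : ∀ x → degree G x ≤ 32 * Q * s

-- `r` may use three quarters of the budget `n s / Q`: three kinds of deletion at `n s / (8 Q)`
-- ordered pairs each, doubled by `edges-prune`. The last quarter is reserved for trimming.
Removable : ∀ {n} → ℕ → ℕ → Graph n → Set
Removable {n} Q s G = Σ (Graph n) λ H → H ⊆G G × labelledC5 H ≡ 0 ×
  Σ ℕ λ r → edges G ≤ edges H + r × 4 * Q * r ≤ 3 * (n * s)

-- `s * (n * n)` plays the role of `n^(5/2)`.
ManyOrRemovable : ∀ {n} → ℕ → ℕ → ℕ → Graph n → Set
ManyOrRemovable {n} Q s K G = s * (n * n) ≤ K * labelledC5 G ⊎ Removable Q s G

area : ∀ {n} → (Fin n → Fin n → Bool) → ℕ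
area {n} W = Σ² n (indicator W)

-- Expresses that `W` is a union of products of two cells of `P`.
Measurable : ∀ {n k} → (Fin n → Fin k) → (Fin n → Fin n → Bool) → Set
Measurable P W = ∀ x x′ y y′ → P x ≡ P x′ → P y ≡ P y′ → W x y ≡ W x′ y′

-- A round may enlarge the sparse set by `n²/Γ` without a restart. In `40 = 4 * 10` the 4 comes from
-- `n ≤ 4 s²` and the 10 from the threshold for bad cells; `12 Q` is the weight `w` in
-- `bad-removed`. `regularity h` is the `1 + A` of `cycles-from-counting`.
Γ regularity : ℕ → ℕ
Γ Q = 40 * (12 * Q * (12 * Q))
regularity h = 3 + h * h + 4 * (h * h * h * h)

module Cleaning (Q n s k z : ℕ) {{_ : NonZero Q}} (G : Graph n) (setting : Setting Q n s G)
  (P : Fin n → Fin k) (W₀ W : Fin n → Fin n → Bool)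
  (W₀-measurable : Measurable P W₀) (W₀⊆W : ∀ x y → W₀ x y ≡ true → W x y ≡ true)
  (W₀-sparse : 32 * Q * s * removed G W₀ ≤ area W₀)
  (W-close : Γ Q * area W ≤ Γ Q * area W₀ + n * n)
  (kh≤s : k * (32 * Q) ≤ s) where

  open Setting setting
  open ≤-Reasoning

  private
    h d κ w : ℕ
    h = 32 * Q
    d = h * s
    -- Tiny cells have at most `n/κ` vertices together, and degrees at most `h s` then give
    -- `n s / (8 Q)`. The weight `w` satisfies `2 w = 3 * 8 Q`, matching the three terms of
    -- `bad-removed`.
    κ = 8 * Q * h
    w = 12 * Q

    instance
      s≢0 : NonZero s
      s≢0 = >-nonZero 1≤s
      n≢0 : NonZero n
      n≢0 = >-nonZero (≤-trans (*-mono-≤ 1≤s 1≤s) s²≤n)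

  cell : Fin k → Fin n → Bool
  cell i x = P x == i

  U : Fin n → Fin n → Bool
  U x y = W x y ∧ not (W₀ x y)

  defect : Fin k → Fin k → ℕ
  defect i j = Σ² n (restrict (indicator U) (cell i) (cell j))

  tiny : Fin k → Bool
  tiny i = ⌊ κ * k * count (cell i) <? n ⌋

  -- One tenth is the share of missing pairs that `dense-cells⇒many-cycles` tolerates.
  bad : Fin k → Fin k → Bool
  bad i j = ⌊ count (cell i) * count (cell j) ≤? 10 * defect i j ⌋

  ok : Fin n → Fin n → Bool
  ok x y = not (W₀ x y) ∧ (not (tiny (P x)) ∧ not (bad (P x) (P y)))

  cells-cover : ΣFin k (λ i → count (cell i)) ≡ n
  cells-cover = trans (Σ²-cong′ λ i x → ≡-sym (*-identityʳ [ cell i x ]))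
    (trans (≡-sym (Σ-partition n k P (λ _ _ → 1))) (trans (Σ-const n 1) (*-identityʳ n)))
    where
    Σ²-cong′ : ∀ {F F′ : Fin k → Fin n → ℕ} → (∀ i x → F i x ≡ F′ i x) →
      ΣFin k (λ i → ΣFin n (F i)) ≡ ΣFin k (λ i → ΣFin n (F′ i))
    Σ²-cong′ e = Σ-cong k λ i → Σ-cong n (e i)

  U-area : Γ Q * area U ≤ n * n
  U-area = +-cancelˡ-≤ (Γ Q * area W₀) _ _ (begin
    Γ Q * area W₀ + Γ Q * area U  ≡⟨ *-distribˡ-+ (Γ Q) (area W₀) (area U) ⟨
    Γ Q * (area W₀ + area U)      ≤⟨ *-monoʳ-≤ (Γ Q) (≤-trans (≤-reflexive (≡-sym (Σ²-+ n _ _)))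
                                       (Σ²-mono n λ x y → disjoint (W₀ x y) (W x y) (W₀⊆W x y))) ⟩
    Γ Q * area W                  ≤⟨ W-close ⟩
    Γ Q * area W₀ + n * n         ∎)
    where
    disjoint : ∀ a b → (a ≡ true → b ≡ true) → [ a ] + [ b ∧ not a ] ≤ [ b ]
    disjoint true  b     a⇒b rewrite a⇒b refl = ≤-refl
    disjoint false true  a⇒b = ≤-refl
    disjoint false false a⇒b = ≤-refl

  bad-area : Σ² n (λ x y → [ bad (P x) (P y) ]) ≤ 10 * area U
  bad-area = begin
    Σ² n (λ x y → [ bad (P x) (P y) ])
      ≡⟨ Σ²-partition n k P (λ i j _ _ → [ bad i j ]) ⟩
    Σ² k (λ i j → Σ² n (λ x y → [ cell i x ] * [ cell j y ] * [ bad i j ]))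
      ≡⟨ Σ²-cong k (λ i j → trans (Σ-cong n λ x → Σ-*ʳ n [ bad i j ] _) (trans (Σ-*ʳ n [ bad i j ] _)
           (cong (_* [ bad i j ]) (Σ²-product n (λ x → [ cell i x ]) (λ y → [ cell j y ]))))) ⟩
    Σ² k (λ i j → count (cell i) * count (cell j) * [ bad i j ])
      ≤⟨ Σ²-mono k large ⟩
    Σ² k (λ i j → 10 * defect i j)
      ≡⟨ trans (Σ²-*ˡ k 10 defect) (cong (10 *_) (≡-sym (Σ²-partition n k P (λ _ _ x y → [ U x y ])))) ⟩
    10 * area U ∎
    where
    large : ∀ i j → count (cell i) * count (cell j) * [ bad i j ] ≤ 10 * defect i j
    large i j with count (cell i) * count (cell j) ≤? 10 * defect i j
    ... | yes c≤ = ≤-trans (≤-reflexive (*-identityʳ _)) c≤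
    ... | no  _  = ≤-trans (≤-reflexive (*-zeroʳ (count (cell i) * count (cell j)))) z≤n

  -- `crossing-bound` is applied once per cell `i`, against the union `Y i` of all its bad partners.
  -- So the terms `s² count (cell i)` add up to `s² n` only, and the term `s² d` occurs `k` times,
  -- which `k h ≤ s` makes affordable.
  bad-removed : 8 * Q * removed G (λ x y → bad (P x) (P y)) ≤ n * s
  bad-removed = *-cancelˡ-≤ (3 * s) {{m*n≢0 3 s}} (begin
    3 * s * (8 * Q * R)                              ≡⟨ e₁ Q s R ⟩
    2 * (s * w) * R                                  ≡⟨ cong (2 * (s * w) *_) split ⟩
    2 * (s * w) * ΣFin k (λ i → crossing G (cell i) (Y i))
      ≡⟨ Σ-*ˡ k (2 * (s * w)) _ ⟨
    ΣFin k (λ i → 2 * (s * w) * crossing G (cell i) (Y i))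
      ≤⟨ Σ-mono k (λ i → crossing-bound G codegree≤1 degree≤ s w (cell i) (Y i)) ⟩
    ΣFin k (λ i → s * s * count (cell i) + s * s * d + w * w * (count (cell i) * count (Y i)))
      ≡⟨ trans (Σ-+ k _ _) (cong₂ _+_ (trans (Σ-+ k _ _) (cong₂ _+_ (Σ-*ˡ k (s * s) _) (Σ-const k _))) (Σ-*ˡ k (w * w) _)) ⟩
    s * s * ΣFin k (λ i → count (cell i)) + k * (s * s * d) + w * w * ΣFin k (λ i → count (cell i) * count (Y i))
      ≡⟨ cong₂ (λ p q → s * s * p + k * (s * s * d) + w * w * q) cells-cover bad-columns ⟩
    s * s * n + k * (s * s * d) + w * w * Σ² n (λ x y → [ bad (P x) (P y) ])
      ≤⟨ +-mono-≤ (+-monoʳ-≤ (s * s * n) few-cells) small-area ⟩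
    s * s * n + s * s * n + s * s * n                ≡⟨ e₂ s n ⟩
    3 * s * (n * s)                                  ∎)
    where
    R : ℕ
    R = removed G (λ x y → bad (P x) (P y))
    Y : Fin k → Fin n → Bool
    Y i y = bad i (P y)
    e₁ : ∀ Q s R → 3 * s * (8 * Q * R) ≡ 2 * (s * (12 * Q)) * R
    e₁ = solve-∀
    e₂ : ∀ s n → s * s * n + s * s * n + s * s * n ≡ 3 * s * (n * s)
    e₂ = solve-∀
    split : R ≡ ΣFin k (λ i → crossing G (cell i) (Y i))
    split = trans (Σ-partition n k P (λ i x → ΣFin n λ y → [ Y i y ] * edge G x y)) (Σ-cong k λ i →
      trans (Σ-cong n λ x → ≡-sym (Σ-*ˡ n [ cell i x ] _)) (trans (Σ-swap n n _) (Σ-cong n λ y →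
      trans (Σ-cong n λ x → swap [ cell i x ] [ Y i y ] (edge G x y)) (Σ-*ˡ n [ Y i y ] _))))
      where
      swap : ∀ p q r → p * (q * r) ≡ q * (p * r)
      swap = solve-∀
    bad-columns : ΣFin k (λ i → count (cell i) * count (Y i)) ≡ Σ² n (λ x y → [ bad (P x) (P y) ])
    bad-columns = trans (Σ-cong k λ i → ≡-sym (Σ-*ʳ n (count (Y i)) _))
      (≡-sym (Σ-partition n k P (λ i _ → count (Y i))))
    few-cells : k * (s * s * d) ≤ s * s * n
    few-cells = begin
      k * (s * s * d)       ≡⟨ e k s h ⟩
      s * s * (k * h * s)   ≤⟨ *-monoʳ-≤ (s * s) (≤-trans (*-monoˡ-≤ s kh≤s) s²≤n) ⟩
      s * s * n             ∎
      where
      e : ∀ k s h → k * (s * s * (h * s)) ≡ s * s * (k * h * s)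
      e = solve-∀
    small-area : w * w * Σ² n (λ x y → [ bad (P x) (P y) ]) ≤ s * s * n
    small-area = *-cancelˡ-≤ 4 (begin
      4 * (w * w * Σ² n (λ x y → [ bad (P x) (P y) ]))  ≤⟨ *-monoʳ-≤ 4 (*-monoʳ-≤ (w * w) bad-area) ⟩
      4 * (w * w * (10 * area U))                       ≡⟨ e (w * w) (area U) ⟩
      Γ Q * area U                                      ≤⟨ U-area ⟩
      n * n                                             ≤⟨ *-monoʳ-≤ n n≤4s² ⟩
      n * (4 * (s * s))                                 ≡⟨ e′ n s ⟩
      4 * (s * s * n)                                   ∎)
      where
      e : ∀ ww u → 4 * (ww * (10 * u)) ≡ 40 * ww * u
      e = solve-∀
      e′ : ∀ n s → n * (4 * (s * s)) ≡ 4 * (s * s * n)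
      e′ = solve-∀

  W₀-removed : 8 * Q * removed G W₀ ≤ n * s
  W₀-removed = *-cancelˡ-≤ (4 * s) {{m*n≢0 4 s}} (begin
    4 * s * (8 * Q * removed G W₀)   ≡⟨ e₁ Q s (removed G W₀) ⟩
    32 * Q * s * removed G W₀        ≤⟨ W₀-sparse ⟩
    area W₀                          ≤⟨ Σ²-bound n 1 (λ x y → []≤1 (W₀ x y)) ⟩
    n * (n * 1)                      ≤⟨ *-monoʳ-≤ n (≤-trans (≤-reflexive (*-identityʳ n)) n≤4s²) ⟩
    n * (4 * (s * s))                ≡⟨ e₂ n s ⟩
    4 * s * (n * s)                  ∎)
    where
    e₁ : ∀ Q s r → 4 * s * (8 * Q * r) ≡ 32 * Q * s * r
    e₁ = solve-∀
    e₂ : ∀ n s → n * (4 * (s * s)) ≡ 4 * s * (n * s)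
    e₂ = solve-∀

  tiny-count : κ * count (λ x → tiny (P x)) ≤ n
  tiny-count = *-cancelˡ-≤ k {{k≢0}} (begin
    k * (κ * count (λ x → tiny (P x)))
      ≡⟨ trans (e k κ _) (cong (κ * k *_) (Σ-partition n k P (λ i _ → [ tiny i ]))) ⟩
    κ * k * ΣFin k (λ i → ΣFin n λ x → [ cell i x ] * [ tiny i ])
      ≡⟨ cong (κ * k *_) (Σ-cong k λ i → Σ-*ʳ n [ tiny i ] _) ⟩
    κ * k * ΣFin k (λ i → count (cell i) * [ tiny i ])
      ≡⟨ Σ-*ˡ k (κ * k) _ ⟨
    ΣFin k (λ i → κ * k * (count (cell i) * [ tiny i ]))
      ≤⟨ Σ-bound k n small ⟩
    k * n ∎)
    where
    e : ∀ k κ c → k * (κ * c) ≡ κ * k * c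
    e = solve-∀
    fin⇒nonZero : ∀ {m} → Fin m → NonZero m
    fin⇒nonZero zero    = _
    fin⇒nonZero (suc _) = _
    k≢0 : NonZero k
    k≢0 = fin⇒nonZero (P (Fin.fromℕ< (>-nonZero⁻¹ n)))
    small : ∀ i → κ * k * (count (cell i) * [ tiny i ]) ≤ n
    small i with κ * k * count (cell i) <? n
    ... | yes c< = ≤-trans (≤-reflexive (cong (κ * k *_) (*-identityʳ _))) (<⇒≤ c<)
    ... | no  _  = ≤-trans (≤-reflexive (trans (cong (κ * k *_) (*-zeroʳ (count (cell i)))) (*-zeroʳ (κ * k)))) z≤n

  tiny-removed : 8 * Q * removed G (λ x _ → tiny (P x)) ≤ n * s
  tiny-removed = begin
    8 * Q * removed G (λ x _ → tiny (P x))
      ≤⟨ *-monoʳ-≤ (8 * Q) (Σ-mono n λ x → ≤-trans (≤-reflexive (Σ-*ˡ n [ tiny (P x) ] _)) (*-monoʳ-≤ [ tiny (P x) ] (degree≤ x))) ⟩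
    8 * Q * ΣFin n (λ x → [ tiny (P x) ] * d)
      ≡⟨ trans (cong (8 * Q *_) (Σ-*ʳ n d _)) (e (8 * Q) _ h s) ⟩
    κ * count (λ x → tiny (P x)) * s
      ≤⟨ *-monoˡ-≤ s tiny-count ⟩
    n * s ∎
    where
    e : ∀ q c h s → q * (c * (h * s)) ≡ q * h * c * s
    e = solve-∀

  not-ok-removed : 8 * Q * removed G (λ x y → not (ok x y)) ≤ 3 * (n * s)
  not-ok-removed = begin
    8 * Q * removed G (λ x y → not (ok x y))
      ≤⟨ *-monoʳ-≤ (8 * Q) (≤-trans
           (Σ²-mono n λ x y → cases (W₀ x y) (tiny (P x)) (bad (P x) (P y)) (edge G x y))
           (≤-reflexive (trans (Σ²-+ n _ _) (cong (_+ removed G (λ x y → bad (P x) (P y))) (Σ²-+ n _ _))))) ⟩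
    8 * Q * (removed G W₀ + removed G (λ x _ → tiny (P x)) + removed G (λ x y → bad (P x) (P y)))
      ≡⟨ e (8 * Q) (removed G W₀) _ _ ⟩
    8 * Q * removed G W₀ + 8 * Q * removed G (λ x _ → tiny (P x)) + 8 * Q * removed G (λ x y → bad (P x) (P y))
      ≤⟨ +-mono-≤ (+-mono-≤ W₀-removed tiny-removed) bad-removed ⟩
    n * s + n * s + n * s
      ≡⟨ e′ (n * s) ⟩
    3 * (n * s) ∎
    where
    e : ∀ q a b c → q * (a + b + c) ≡ q * a + q * b + q * c
    e = solve-∀
    e′ : ∀ a → a + a + a ≡ 3 * a
    e′ = solve-∀
    cases : ∀ a b c t → [ not (not a ∧ (not b ∧ not c)) ] * t ≤ [ a ] * t + [ b ] * t + [ c ] * t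
    cases true  b     c     t = ≤-trans (m≤m+n (1 * t) _) (m≤m+n _ _)
    cases false true  c     t = m≤m+n (1 * t) _
    cases false false true  t = ≤-refl
    cases false false false t = z≤n

  cleaned : Graph n
  cleaned = prune G ok

  record Surviving (x y : Fin n) : Set where
    field
      large : n ≤ κ * k * count (cell (P x))
      dense : 10 * Σ² n (restrict (indicator W) (cell (P x)) (cell (P y))) ≤ count (cell (P x)) * count (cell (P y))

  -- A surviving pair lies outside `W₀`, and by measurability so does the whole product of its two
  -- cells. There `W` and `U` coincide, so a bound on `defect` is a bound on `W`.
  surviving : ∀ x y → adj cleaned x y ≡ true → Surviving x y
  surviving x y e = record
    { large = ≮⇒≥ (⌊⌋-no⁻¹ (κ * k * count (cell (P x)) <? n) (not-true (proj₁ ok₂)))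
    ; dense = ≤-trans (*-monoʳ-≤ 10 (Σ²-mono n λ u v → inside u v))
        (<⇒≤ (≰⇒> (⌊⌋-no⁻¹ (count (cell (P x)) * count (cell (P y)) ≤? 10 * defect (P x) (P y)) (not-true (proj₂ ok₂)))))
    }
    where
    not-true : ∀ {b} → not b ≡ true → b ≡ false
    not-true {false} _ = refl
    ok₁ : ok x y ≡ true
    ok₁ = proj₂ (prune-adj G ok x y e)
    ok₂ : not (tiny (P x)) ≡ true × not (bad (P x) (P y)) ≡ true
    ok₂ = ∧-true (not (tiny (P x))) _ (proj₂ (∧-true (not (W₀ x y)) _ ok₁))
    W₀xy : W₀ x y ≡ false
    W₀xy = not-true (proj₁ (∧-true (not (W₀ x y)) _ ok₁))
    inside : ∀ u v → restrict (indicator W) (cell (P x)) (cell (P y)) u v ≤ restrict (indicator U) (cell (P x)) (cell (P y)) u v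
    inside u v with P u Fin.≟ P x | P v Fin.≟ P y
    ... | no  _ | _     = z≤n
    ... | yes _ | no  _ = z≤n
    ... | yes p | yes q rewrite trans (W₀-measurable u x v y p q) W₀xy | ∧-identityʳ (W u v) = ≤-refl

  module _ (regular : LowerRegular z (32 * Q * s) (complement W) (edge G))
    (z≡ : z ≡ 2 * (κ * k * (κ * k) * (κ * k) * (κ * k) * (κ * k)) * regularity h)
    (z≤ : 5 * z * (h * h * h * h * h * h * h) ≤ s) where

    -- Each of the five cells has at least `n/(κ k)` vertices and less than a tenth of each
    -- consecutive product lies in `W`. This gives at least `n⁵ / (2 (κ k)⁵)` cycles in the
    -- complement, which the counting lemma transfers to `G` itself.
    fiveCycle⇒many : FiveCycle cleaned → s * (n * n) ≤ z * (h * h * h * h * h) * labelledC5 G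
    fiveCycle⇒many cycle = cycles-from-counting h s n z (κ * k) (labelledC5 G) T 1≤s s²≤n z≤ z≡ n⁵≤
      (countingLemma z d K₁ K₂ K₃ K₄ K₅
        (K≤1 V₁ V₂) (K≤1 V₂ V₃) (K≤1 V₄ V₅) (K≤1 V₅ V₁)
        (reg V₁ V₂) (reg V₂ V₃) (reg V₃ V₄) (reg V₄ V₅) (reg V₅ V₁))
      where
      open FiveCycle cycle renaming (d to d₀)
      open Counting G d codegree≤1 degree≤ using (countingLemma)
      module S₁ = Surviving (surviving a b ab)
      module S₂ = Surviving (surviving b c bc)
      module S₃ = Surviving (surviving c d₀ cd)
      module S₄ = Surviving (surviving d₀ e de)
      module S₅ = Surviving (surviving e a ea)
      V₁ V₂ V₃ V₄ V₅ : Fin n → Bool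
      V₁ = cell (P a)
      V₂ = cell (P b)
      V₃ = cell (P c)
      V₄ = cell (P d₀)
      V₅ = cell (P e)
      K₁ K₂ K₃ K₄ K₅ : Mat n
      K₁ = restrict (complement W) V₁ V₂
      K₂ = restrict (complement W) V₂ V₃
      K₃ = restrict (complement W) V₃ V₄
      K₄ = restrict (complement W) V₄ V₅
      K₅ = restrict (complement W) V₅ V₁
      K≤1 : ∀ X Y x y → restrict (complement W) X Y x y ≤ 1
      K≤1 X Y x y = *-mono-≤ (*-mono-≤ ([]≤1 (X x)) ([]≤1 (Y y))) ([]≤1 (not (W x y)))
      reg : ∀ X Y → BilinearRegular z d (restrict (complement W) X Y) (edge G)
      reg X Y = bilinearRegular-restrict z d (complement W) (edge G) X Y
        (lowerRegular⇒bilinearRegular z d (complement W) (edge G) regular)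
      T : ℕ
      T = tr₅ K₁ K₂ K₃ K₄ K₅
      n⁵≤ : n * n * (n * n * n) ≤ κ * k * (κ * k) * (κ * k) * (κ * k) * (κ * k) * (2 * T)
      n⁵≤ = begin
        n * n * (n * n * n)
          ≤⟨ *-mono-≤ (*-mono-≤ S₁.large S₂.large) (*-mono-≤ (*-mono-≤ S₃.large S₄.large) S₅.large) ⟩
        κ * k * count V₁ * (κ * k * count V₂) * (κ * k * count V₃ * (κ * k * count V₄) * (κ * k * count V₅))
          ≡⟨ collect (κ * k) (count V₁) (count V₂) (count V₃) (count V₄) (count V₅) ⟩
        κ * k * (κ * k) * (κ * k) * (κ * k) * (κ * k) * (count V₁ * count V₂ * (count V₃ * (count V₄ * count V₅)))
          ≤⟨ *-monoʳ-≤ (κ * k * (κ * k) * (κ * k) * (κ * k) * (κ * k))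
               (dense-cells⇒many-cycles W V₁ V₂ V₃ V₄ V₅ S₁.dense S₂.dense S₃.dense S₄.dense S₅.dense) ⟩
        κ * k * (κ * k) * (κ * k) * (κ * k) * (κ * k) * (2 * T) ∎
        where
        collect : ∀ m p q r t u → m * p * (m * q) * (m * r * (m * t) * (m * u)) ≡ m * m * m * m * m * (p * q * (r * (t * u)))
        collect = solve-∀

    many-or-removable : ManyOrRemovable Q s (z * (h * h * h * h * h)) G
    many-or-removable with labelledC5 cleaned ≟ 0
    ... | no  ne = inj₁ (fiveCycle⇒many (labelledC5≢0⇒fiveCycle cleaned ne))
    ... | yes e  = inj₂ (cleaned , prune-⊆ G ok , e , 2 * removed G (λ x y → not (ok x y)) , edges-prune G ok ,
      ≤-trans (≤-reflexive (double Q (removed G (λ x y → not (ok x y))))) not-ok-removed)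
      where
      double : ∀ Q r → 4 * Q * (2 * r) ≡ 8 * Q * r
      double = solve-∀

-- The increment argument

module Enlarge {n m} (G : Graph n) (R : Fin n → Fin m) (W : Fin n → Fin n → Bool) (X Y : Fin n → Bool) where

  enlarged : Fin n → Fin n → Bool
  enlarged x y = W x y ∨ (X x ∧ Y y)

  bit : Bool → Fin 2
  bit false = zero
  bit true  = suc zero

  bit-injective : ∀ a b → bit a ≡ bit b → a ≡ b
  bit-injective false false _ = refl
  bit-injective true  true  _ = refl

  -- The common refinement with `X` and `Y`. Cells may be empty, so the number of labels is exactly
  -- `4 m` whatever `n` is.
  refined : Fin n → Fin (m * 2 * 2)
  refined x = combine (combine (R x) (bit (X x))) (bit (Y x))

  refined⇒ : ∀ x x′ → refined x ≡ refined x′ → R x ≡ R x′ × X x ≡ X x′ × Y x ≡ Y x′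
  refined⇒ x x′ e
    with e₁ , e₂ ← Finₚ.combine-injective (combine (R x) (bit (X x))) (bit (Y x)) (combine (R x′) (bit (X x′))) (bit (Y x′)) e
    with e₃ , e₄ ← Finₚ.combine-injective (R x) (bit (X x)) (R x′) (bit (X x′)) e₁
    = e₃ , bit-injective _ _ e₄ , bit-injective _ _ e₂

  enlarged-measurable : Measurable R W → Measurable refined enlarged
  enlarged-measurable W-measurable x x′ y y′ ex ey
    with rx , Xx , _ ← refined⇒ x x′ ex
    with ry , _ , Yy ← refined⇒ y y′ ey
    = cong₂ _∨_ (W-measurable x x′ y y′ rx ry) (cong₂ _∧_ Xx Yy)

  -- `gain` counts only the new pairs, whereas `loss` counts all adjacent pairs of the rectangle,
  -- including those already in `W`.
  gain loss : ℕ
  gain = bil (complement W) (λ x → [ X x ]) (λ y → [ Y y ])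
  loss = bil (edge G) (λ x → [ X x ]) (λ y → [ Y y ])

  enlarged-area : area enlarged ≡ area W + gain
  enlarged-area = trans (Σ²-cong n λ x y → cases (W x y) (X x) (Y y)) (Σ²-+ n _ _)
    where
    cases : ∀ w a b → [ w ∨ (a ∧ b) ] ≡ [ w ] + [ not w ] * ([ a ] * [ b ])
    cases true  a b = refl
    cases false a b = trans ([∧] a b) (≡-sym (*-identityˡ _))

  enlarged-removed : removed G enlarged ≤ removed G W + loss
  enlarged-removed = ≤-trans (Σ²-mono n λ x y → cases (W x y) (X x) (Y y) (edge G x y)) (≤-reflexive (Σ²-+ n _ _))
    where
    cases : ∀ w a b g → [ w ∨ (a ∧ b) ] * g ≤ [ w ] * g + g * ([ a ] * [ b ])
    cases true  a b g = m≤m+n (1 * g) _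
    cases false a b g = ≤-reflexive (trans (cong (_* g) ([∧] a b)) (*-comm _ g))

Irregular : ∀ {n} → ℕ → ℕ → Mat n → Mat n → (X Y : Fin n → Bool) → Set
Irregular {n} z M K g X Y =
  z * M * bil g (λ x → [ X x ]) (λ y → [ Y y ]) + n * n < z * bil K (λ x → [ X x ]) (λ y → [ Y y ])

-- Decided by searching all pairs of subsets of `Fin n`; Boolean functions are tabulated to reach
-- the finite search.
regular-or-irregular : ∀ {n} z M (K g : Mat n) →
  LowerRegular z M K g ⊎ ∃₂ λ X Y → Irregular z M K g X Y
regular-or-irregular {n} z M K g
  with anySubset? (λ (X : Subset n) → anySubset? (λ (Y : Subset n) →
    (z * M * bil g (λ x → [ lookup X x ]) (λ y → [ lookup Y y ]) + n * n) <?
    (z * bil K (λ x → [ lookup X x ]) (λ y → [ lookup Y y ]))))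
... | yes (X , Y , irregular) = inj₂ (lookup X , lookup Y , irregular)
... | no  ¬irregular = inj₁ λ X Y → subst₂ (λ p q → z * p ≤ z * M * q + n * n)
  (tabulated K X Y) (tabulated g X Y)
  (≮⇒≥ λ irregular → ¬irregular (tabulate X , tabulate Y , irregular))
  where
  tabulated : ∀ (L : Mat n) (X Y : Fin n → Bool) →
    bil L (λ x → [ lookup (tabulate X) x ]) (λ y → [ lookup (tabulate Y) y ]) ≡ bil L (λ x → [ X x ]) (λ y → [ Y y ])
  tabulated L X Y = bil-cong L (λ x → cong [_] (lookup∘tabulate X x)) (λ y → cong [_] (lookup∘tabulate Y y))

weaken : ∀ {n} Q s {K K′} (G : Graph n) → K ≤ K′ → ManyOrRemovable Q s K G → ManyOrRemovable Q s K′ G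
weaken Q s G K≤K′ (inj₁ many) = inj₁ (≤-trans many (*-monoˡ-≤ (labelledC5 G) K≤K′))
weaken Q s G K≤K′ (inj₂ r)    = inj₂ r

record SparseSet (Q s k : ℕ) {n} (G : Graph n) : Set where
  field
    partition  : Fin n → Fin k
    pairs      : Fin n → Fin n → Bool
    measurable : Measurable partition pairs
    sparse     : 32 * Q * s * removed G pairs ≤ area pairs

open SparseSet

-- j bounds the number of rounds still to come, and i the number of steps left in the current round,
-- so the constants K and N are found by recursion on j and i, before n is known.
OuterPotential : ∀ {n} (Q j s k : ℕ) (G : Graph n) → SparseSet Q s k G → Set
OuterPotential {n} Q j s k G S₀ = suc (Γ Q) * (n * n) ≤ Γ Q * area (pairs S₀) + j * (n * n)

-- Without subtraction, this says `z (area − M removed) ≥ (z + 1 − i) n²`. The left side never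
-- exceeds `z n²`, so a round that starts with `i = z + 1` makes at most `z` increments.
InnerPotential : ∀ {n} (Q z i s m : ℕ) (G : Graph n) → SparseSet Q s m G → Set
InnerPotential {n} Q z i s m G S =
  z * (32 * Q * s) * removed G (pairs S) + suc z * (n * n) ≤ z * area (pairs S) + i * (n * n)

Outer : ℕ → ℕ → ℕ → Set
Outer Q j k = Σ ℕ λ K → Σ ℕ λ N → ∀ n s (G : Graph n) → Setting Q n s G → N ≤ s →
  (S₀ : SparseSet Q s k G) → OuterPotential Q j s k G S₀ → ManyOrRemovable Q s K G

Inner : (Q j k z i m : ℕ) → Set
Inner Q j k z i m = Σ ℕ λ K → Σ ℕ λ N → ∀ n s (G : Graph n) → Setting Q n s G → N ≤ s →
  (S₀ : SparseSet Q s k G) → OuterPotential Q (suc j) s k G S₀ →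
  (S : SparseSet Q s m G) → (∀ x y → pairs S₀ x y ≡ true → pairs S x y ≡ true) →
  InnerPotential Q z i s m G S → ManyOrRemovable Q s K G

area≤n² : ∀ {n} (W : Fin n → Fin n → Bool) → area W ≤ n * n
area≤n² {n} W = ≤-trans (Σ²-bound n 1 λ x y → []≤1 (W x y)) (≤-reflexive (cong (n *_) (*-identityʳ n)))

-- The end of both recursions: with no rounds or no steps left, the potential would force `area W`
-- above `n²`.
exhausted : ∀ {Q n s} {G : Graph n} → Setting Q n s G → ∀ c (W : Fin n → Fin n → Bool) →
  ¬ (suc c * (n * n) ≤ c * area W)
exhausted {n = n} setting c W h = <⇒≱ (m<n+m (c * (n * n)) (*-mono-≤ n>0 n>0)) (≤-trans h (*-monoʳ-≤ c (area≤n² W)))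
  where
  open Setting setting
  n>0 : 0 < n
  n>0 = ≤-trans (*-mono-≤ 1≤s 1≤s) s²≤n

module Increment {n} (Q s m z i : ℕ) (G : Graph n) (S : SparseSet Q s m G)
  (potential : InnerPotential Q z (suc i) s m G S)
  (X Y : Fin n → Bool) (irregular : Irregular z (32 * Q * s) (complement (pairs S)) (edge G) X Y) where

  open Enlarge G (partition S) (pairs S) X Y
  open ≤-Reasoning

  private
    W : Fin n → Fin n → Bool
    W = pairs S
    M : ℕ
    M = 32 * Q * s

  -- Preserves `sparse` under enlargement. The strict inequality in `Irregular` forces `z ≠ 0`, so
  -- `z` can be cancelled.
  profitable : M * loss ≤ gain
  profitable = *-cancelˡ-≤ z {{≢-nonZero z≢0}} (begin
    z * (M * loss)         ≡⟨ *-assoc z M loss ⟨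
    z * M * loss           ≤⟨ m≤m+n _ (n * n) ⟩
    z * M * loss + n * n   ≤⟨ <⇒≤ irregular ⟩
    z * gain               ∎)
    where
    z≢0 : z ≢ 0
    z≢0 e = n≮0 (subst (z * M * loss + n * n <_) (cong (_* gain) e) irregular)

  incremented : SparseSet Q s (m * 2 * 2) G
  incremented = record
    { partition = refined
    ; pairs = enlarged
    ; measurable = enlarged-measurable (measurable S)
    ; sparse = begin
        M * removed G enlarged             ≤⟨ *-monoʳ-≤ M enlarged-removed ⟩
        M * (removed G W + loss)           ≡⟨ *-distribˡ-+ M (removed G W) loss ⟩
        M * removed G W + M * loss         ≤⟨ +-mono-≤ (sparse S) profitable ⟩
        area W + gain                      ≡⟨ enlarged-area ⟨
        area enlarged                      ∎
    }

  incremented-⊇ : ∀ x y → W x y ≡ true → pairs incremented x y ≡ true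
  incremented-⊇ x y w = cong (_∨ (X x ∧ Y y)) w

  -- The summand `n²` in `Irregular` pays for lowering `i` by one.
  incremented-potential : InnerPotential Q z i s (m * 2 * 2) G incremented
  incremented-potential = begin
    z * M * removed G enlarged + suc z * (n * n)
      ≤⟨ +-monoˡ-≤ (suc z * (n * n)) (*-monoʳ-≤ (z * M) enlarged-removed) ⟩
    z * M * (removed G W + loss) + suc z * (n * n)
      ≡⟨ e₁ (z * M) (removed G W) loss (suc z * (n * n)) ⟩
    z * M * removed G W + suc z * (n * n) + z * M * loss
      ≤⟨ +-monoˡ-≤ (z * M * loss) potential ⟩
    z * area W + suc i * (n * n) + z * M * loss
      ≡⟨ e₂ (z * area W) i (n * n) (z * M * loss) ⟩
    z * area W + i * (n * n) + (z * M * loss + n * n)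
      ≤⟨ +-monoʳ-≤ (z * area W + i * (n * n)) (<⇒≤ irregular) ⟩
    z * area W + i * (n * n) + z * gain
      ≡⟨ e₃ z (area W) (i * (n * n)) gain ⟩
    z * (area W + gain) + i * (n * n)
      ≡⟨ cong (λ t → z * t + i * (n * n)) enlarged-area ⟨
    z * area enlarged + i * (n * n) ∎
    where
    e₁ : ∀ a r l c → a * (r + l) + c ≡ a * r + c + a * l
    e₁ = solve-∀
    e₂ : ∀ a i m l → a + (1 + i) * m + l ≡ a + i * m + (l + m)
    e₂ = solve-∀
    e₃ : ∀ z a c g → z * a + c + z * g ≡ z * (a + g) + c
    e₃ = solve-∀

-- The removal statement for `1/Q` in place of ε, with `s` for `√n` and labelled 5-cycles for
-- copies.
Removal : ℕ → Set
Removal Q = Σ ℕ λ K → Σ ℕ λ N → ∀ n s (G : Graph n) → C4-free G →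
  1 ≤ s → s * s ≤ n → n ≤ 4 * (s * s) → N ≤ s →
  s * (n * n) ≤ K * labelledC5 G ⊎
  Σ (Graph n) λ H → H ⊆G G × labelledC5 H ≡ 0 × Q * (edges G ∸ edges H) ≤ n * s

-- Recursion over rounds and steps, and reduction to bounded degree.

module _ (Q : ℕ) {{_ : NonZero Q}} where

  private
    h : ℕ
    h = 32 * Q

    cellBound : ℕ → ℕ
    cellBound k = 8 * Q * h * k

    -- The precision `z` demanded by `Cleaning`. It depends on the number `k` of cells at the start
    -- of the round, and not on how far the partition is refined during the round.
    fineness : ℕ → ℕ
    fineness k = 2 * (cellBound k * cellBound k * cellBound k * cellBound k * cellBound k) * regularity h

  -- Three outcomes: an irregular rectangle continues the round with `4 m` cells; a regular set that
  -- has grown enough starts a new round with its `m` cells; otherwise `Cleaning` finishes. Which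
  -- one occurs depends on the graph, so the constants of all three are added.
  inner : ∀ j → (∀ k → Outer Q j k) → ∀ k i m → Inner Q j k (fineness k) i m
  inner j outer k zero    m = 0 , 0 , λ n s G setting _ _ _ S _ potential →
    contradiction (≤-trans (m≤n+m _ (fineness k * (32 * Q * s) * removed G (pairs S)))
                    (≤-trans potential (≤-reflexive (+-identityʳ (fineness k * area (pairs S))))))
      (exhausted setting (fineness k) (pairs S))
  inner j outer k (suc i) m with inner j outer k i (m * 2 * 2) | outer m
  ... | K₁ , N₁ , next | K₂ , N₂ , restart = K₁ + K₂ + K₃ , N₁ + N₂ + N₃ , step
    where
    open ≤-Reasoning
    z K₃ N₃ : ℕ
    z = fineness k
    K₃ = z * (h * h * h * h * h)
    N₃ = 5 * z * (h * h * h * h * h * h * h) + k * h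
    step : ∀ n s (G : Graph n) → Setting Q n s G → N₁ + N₂ + N₃ ≤ s →
      (S₀ : SparseSet Q s k G) → OuterPotential Q (suc j) s k G S₀ →
      (S : SparseSet Q s m G) → (∀ x y → pairs S₀ x y ≡ true → pairs S x y ≡ true) →
      InnerPotential Q z (suc i) s m G S → ManyOrRemovable Q s (K₁ + K₂ + K₃) G
    step n s G setting N≤s S₀ outerPotential S S₀⊆S innerPotential
      with regular-or-irregular z (32 * Q * s) (complement (pairs S)) (edge G)
         | Γ Q * area (pairs S₀) + n * n ≤? Γ Q * area (pairs S)
    ... | inj₂ (X , Y , irregular) | _ = weaken Q s G (≤-trans (m≤m+n K₁ K₂) (m≤m+n _ K₃))
      (next n s G setting (≤-trans (≤-trans (m≤m+n N₁ N₂) (m≤m+n _ N₃)) N≤s) S₀ outerPotential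
        incremented (λ x y → incremented-⊇ x y ∘ S₀⊆S x y) incremented-potential)
      where open Increment Q s m z i G S innerPotential X Y irregular
    ... | inj₁ _ | yes grown = weaken Q s G (≤-trans (m≤n+m K₂ K₁) (m≤m+n _ K₃))
      (restart n s G setting (≤-trans (≤-trans (m≤n+m N₂ N₁) (m≤m+n _ N₃)) N≤s) S (begin
        suc (Γ Q) * (n * n)                                ≤⟨ outerPotential ⟩
        Γ Q * area (pairs S₀) + (n * n + j * (n * n))      ≡⟨ +-assoc (Γ Q * area (pairs S₀)) _ _ ⟨
        Γ Q * area (pairs S₀) + n * n + j * (n * n)        ≤⟨ +-monoˡ-≤ (j * (n * n)) grown ⟩
        Γ Q * area (pairs S) + j * (n * n)                 ∎))
    ... | inj₁ regular | no ¬grown = weaken Q s G (m≤n+m K₃ (K₁ + K₂))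
      (many-or-removable regular refl (≤-trans (m≤m+n _ (k * h)) N₃≤s))
      where
      N₃≤s : N₃ ≤ s
      N₃≤s = ≤-trans (m≤n+m N₃ (N₁ + N₂)) N≤s
      open Cleaning Q n s k z G setting (partition S₀) (pairs S₀) (pairs S) (measurable S₀) S₀⊆S (sparse S₀)
        (<⇒≤ (≰⇒> ¬grown)) (≤-trans (m≤n+m (k * h) _) N₃≤s)

  outer : ∀ j k → Outer Q j k
  outer zero    k = 0 , 0 , λ n s G setting _ S₀ potential →
    contradiction (≤-trans potential (≤-reflexive (+-identityʳ (Γ Q * area (pairs S₀)))))
      (exhausted setting (Γ Q) (pairs S₀))
  -- A round starts with `W = W₀` and `i = z + 1`. The terms in `n²` then agree on both sides, and
  -- the inner potential is `z` times `sparse`.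
  outer (suc j) k with inner j (outer j) k (suc (fineness k)) k
  ... | K , N , next = K , N , λ n s G setting N≤s S₀ potential →
    next n s G setting N≤s S₀ potential S₀ (λ _ _ w → w)
      (+-monoˡ-≤ (suc (fineness k) * (n * n)) (≤-trans (≤-reflexive (*-assoc (fineness k) (32 * Q * s) (removed G (pairs S₀))))
        (*-monoʳ-≤ (fineness k) (sparse S₀))))

  boundedDegreeRemoval : Σ ℕ λ K → Σ ℕ λ N → ∀ n s (G : Graph n) → Setting Q n s G → N ≤ s → ManyOrRemovable Q s K G
  -- The start is the empty set with a single cell; with `Γ + 1` rounds the outer potential holds
  -- trivially.
  boundedDegreeRemoval with outer (suc (Γ Q)) 1
  ... | K , N , removal = K , N , λ n s G setting N≤s → removal n s G setting N≤s
    (record { partition = λ _ → zero ; pairs = λ _ _ → false ; measurable = λ _ _ _ _ _ _ → refl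
            ; sparse = ≤-trans (≤-reflexive (trans (cong (32 * Q * s *_) (Σ-zero n λ x → Σ-zero n λ y → refl)) (*-zeroʳ (32 * Q * s)))) z≤n })
    (m≤n+m (suc (Γ Q) * (n * n)) (Γ Q * area {n} (λ _ _ → false)))

  removal : Removal Q
  removal with boundedDegreeRemoval
  ... | K , N , bounded = K , N , from-bounded
    where
    open ≤-Reasoning
    from-bounded : ∀ n s (G : Graph n) → C4-free G →
      1 ≤ s → s * s ≤ n → n ≤ 4 * (s * s) → N ≤ s →
      s * (n * n) ≤ K * labelledC5 G ⊎
      Σ (Graph n) λ H → H ⊆G G × labelledC5 H ≡ 0 × Q * (edges G ∸ edges H) ≤ n * s
    from-bounded n s G c4 1≤s s²≤n n≤4s² N≤s = go (bounded n s trimmed setting N≤s)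
      where
      d : ℕ
      d = 32 * Q * s
      codegree≤1 : CodegreeAtMostOne G
      codegree≤1 = C4-free⇒codegree G c4
      open Trim G codegree≤1 d
      trimmed⊆G : trimmed ⊆G G
      trimmed⊆G = prune-⊆ G (λ x _ → not (high x))
      setting : Setting Q n s trimmed
      setting = record { 1≤s = 1≤s ; s²≤n = s²≤n ; n≤4s² = n≤4s² ; degree≤ = trimmed-degree
                       ; codegree≤1 = ⊆G⇒codegree {H = trimmed} {G} trimmed⊆G codegree≤1 }
      t : ℕ
      t = removed G (λ x _ → high x)
      edges-trimmed : edges G ≤ edges trimmed + 2 * t
      edges-trimmed = subst (λ u → edges G ≤ edges trimmed + 2 * u)
        (Σ²-cong n λ x y → cong (λ b → [ b ] * edge G x y) (not-involutive (high x)))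
        (edges-prune G (λ x _ → not (high x)))
      -- Trimming spends the quarter of the budget left over by `Removable`.
      few-trimmed : 4 * Q * (2 * t) ≤ n * s
      few-trimmed = *-cancelˡ-≤ (4 * s) {{m*n≢0 4 s {{_}} {{>-nonZero 1≤s}}}} (begin
        4 * s * (4 * Q * (2 * t))   ≡⟨ e₁ s Q t ⟩
        d * t                       ≤⟨ trimmed-removed ⟩
        n * n                       ≤⟨ *-monoʳ-≤ n n≤4s² ⟩
        n * (4 * (s * s))           ≡⟨ e₂ n s ⟩
        4 * s * (n * s)             ∎)
        where
        e₁ : ∀ s Q t → 4 * s * (4 * Q * (2 * t)) ≡ 32 * Q * s * t
        e₁ = solve-∀
        e₂ : ∀ n s → n * (4 * (s * s)) ≡ 4 * s * (n * s)
        e₂ = solve-∀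
      go : ManyOrRemovable Q s K trimmed → s * (n * n) ≤ K * labelledC5 G ⊎
        Σ (Graph n) λ H → H ⊆G G × labelledC5 H ≡ 0 × Q * (edges G ∸ edges H) ≤ n * s
      go (inj₁ many) = inj₁ (≤-trans many (*-monoʳ-≤ K (⊆G⇒labelledC5≤ {H = trimmed} {G} trimmed⊆G)))
      go (inj₂ (H , H⊆ , e , r , edges≤ , few)) = inj₂ (H , (λ x y → trimmed⊆G x y ∘ H⊆ x y) , e ,
        *-cancelˡ-≤ 4 (begin
          4 * (Q * (edges G ∸ edges H))     ≡⟨ *-assoc 4 Q _ ⟨
          4 * Q * (edges G ∸ edges H)       ≤⟨ *-monoʳ-≤ (4 * Q) (m≤n+o⇒m∸n≤o (edges G) (edges H) edges-total) ⟩
          4 * Q * (r + 2 * t)               ≡⟨ *-distribˡ-+ (4 * Q) r (2 * t) ⟩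
          4 * Q * r + 4 * Q * (2 * t)       ≤⟨ +-mono-≤ few few-trimmed ⟩
          3 * (n * s) + n * s               ≡⟨ +-comm (3 * (n * s)) (n * s) ⟩
          4 * (n * s)                       ∎))
        where
        edges-total : edges G ≤ edges H + (r + 2 * t)
        edges-total = begin
          edges G                  ≤⟨ edges-trimmed ⟩
          edges trimmed + 2 * t    ≤⟨ +-monoˡ-≤ (2 * t) edges≤ ⟩
          edges H + r + 2 * t      ≡⟨ +-assoc (edges H) r (2 * t) ⟩
          edges H + (r + 2 * t)    ∎

-- Integer square roots and the passage to the squared form of the statement.

isqrt : ∀ n → Σ ℕ λ s → s * s ≤ n × n < suc s * suc s
isqrt zero = 0 , z≤n , s≤s z≤n
isqrt (suc n) with isqrt n
... | s , s²≤n , n<[1+s]² with suc s * suc s ≤? suc n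
...   | yes [1+s]²≤ = suc s , [1+s]²≤ , ≤-trans (s≤s n<[1+s]²) (*-mono-< (n<1+n (suc s)) (n<1+n (suc s)))
...   | no  [1+s]²≰ = s , m≤n⇒m≤1+n s²≤n , ≰⇒> [1+s]²≰

square-cancel-≤ : ∀ {a b} → a * a ≤ b * b → a ≤ b
square-cancel-≤ {a} {b} a²≤b² with a ≤? b
... | yes a≤b = a≤b
... | no  a≰b = contradiction a²≤b² (<⇒≱ (*-mono-< (≰⇒> a≰b) (≰⇒> a≰b)))

-- By `n ≤ 4 s²` the right side is at most the perfect square `(2 s n²)²`, so the square root can be
-- taken in ℕ.
few-copies : ∀ s n c K → n ≤ 4 * (s * s) → suc (40 * K) ^ 2 * c ^ 2 ≤ 1 ^ 2 * n ^ 5 → 20 * (K * c) ≤ s * (n * n)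
few-copies s n c K n≤4s² h = *-cancelˡ-≤ 2 (begin
  2 * (20 * (K * c))      ≡⟨ e₁ K c ⟩
  40 * K * c              ≤⟨ m≤n+m (40 * K * c) c ⟩
  suc (40 * K) * c        ≤⟨ square-cancel-≤ squares ⟩
  2 * (s * (n * n))       ∎)
  where
  open ≤-Reasoning
  e₁ : ∀ K c → 2 * (20 * (K * c)) ≡ 40 * K * c
  e₁ = solve-∀
  e₂ : ∀ b c → b * c * (b * c) ≡ b * (b * 1) * (c * (c * 1))
  e₂ = solve-∀
  e₃ : ∀ n → 1 * (n * (n * (n * (n * (n * 1))))) ≡ n * (n * n * (n * n))
  e₃ = solve-∀
  e₄ : ∀ s n → 4 * (s * s) * (n * n * (n * n)) ≡ 2 * (s * (n * n)) * (2 * (s * (n * n)))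
  e₄ = solve-∀
  squares : suc (40 * K) * c * (suc (40 * K) * c) ≤ 2 * (s * (n * n)) * (2 * (s * (n * n)))
  squares = begin
    suc (40 * K) * c * (suc (40 * K) * c)    ≡⟨ e₂ (suc (40 * K)) c ⟩
    suc (40 * K) ^ 2 * c ^ 2                 ≤⟨ h ⟩
    1 ^ 2 * n ^ 5                            ≡⟨ e₃ n ⟩
    n * (n * n * (n * n))                    ≤⟨ *-monoˡ-≤ (n * n * (n * n)) n≤4s² ⟩
    4 * (s * s) * (n * n * (n * n))          ≡⟨ e₄ s n ⟩
    2 * (s * (n * n)) * (2 * (s * (n * n)))  ∎

-- Here ε is `(p + 1)/(q + 1)`, and the edge bound is proved with the smaller `1/(q + 1)`. The
-- witnesses are δ `= 1/(40 K + 1)` and the threshold `s₀²`; squaring avoids fractional powers.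
removal⇒theorem : (p q : ℕ) → Removal (suc q) →
    Σ ℕ λ a → Σ ℕ λ b → Σ ℕ λ n₀ →
    (n : ℕ) → n₀ ≤ n → (G : Graph n) → C4-free G →
    suc b ^ 2 * copiesC5 G ^ 2 ≤ suc a ^ 2 * n ^ 5 →
    Σ (Graph n) λ H → H ⊆G G × C5-free H ×
    (suc q ^ 2 * (edges G ∸ edges H) ^ 2 ≤ suc p ^ 2 * n ^ 3)
removal⇒theorem p q (K , N , remove) = 0 , 40 * K , s₀ * s₀ , conclude
  where
  open ≤-Reasoning
  s₀ : ℕ
  -- Copies determine `labelledC5` up to a remainder of at most 9, which contributes
  -- `2 * 9 * K = 18 K` in `not-many`. The successor makes the contradiction strict.
  s₀ = suc (N + 18 * K)
  conclude : (n : ℕ) → s₀ * s₀ ≤ n → (G : Graph n) → C4-free G →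
    suc (40 * K) ^ 2 * copiesC5 G ^ 2 ≤ 1 ^ 2 * n ^ 5 →
    Σ (Graph n) λ H → H ⊆G G × C5-free H ×
    (suc q ^ 2 * (edges G ∸ edges H) ^ 2 ≤ suc p ^ 2 * n ^ 3)
  conclude n n₀≤n G c4 few with isqrt n
  ... | s , s²≤n , n<[1+s]² = go (remove n s G c4 1≤s s²≤n n≤4s² (≤-trans (m≤n⇒m≤1+n (m≤m+n N (18 * K))) s₀≤s))
    where
    s₀≤s : s₀ ≤ s
    s₀≤s with s₀ ≤? s
    ... | yes s₀≤s = s₀≤s
    ... | no  s₀≰s = contradiction (≤-trans (*-mono-≤ (≰⇒> s₀≰s) (≰⇒> s₀≰s)) n₀≤n) (<⇒≱ n<[1+s]²)
    1≤s : 1 ≤ s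
    1≤s = ≤-trans (s≤s z≤n) s₀≤s
    n≤4s² : n ≤ 4 * (s * s)
    n≤4s² = ≤-trans (<⇒≤ n<[1+s]²) (≤-trans (*-mono-≤ 1+s≤2s 1+s≤2s) (≤-reflexive (e s)))
      where
      1+s≤2s : suc s ≤ s + s
      1+s≤2s = +-monoˡ-≤ s 1≤s
      e : ∀ s → (s + s) * (s + s) ≡ 4 * (s * s)
      e = solve-∀
    c : ℕ
    c = copiesC5 G
    labelled≤ : labelledC5 G ≤ 9 + c * 10
    labelled≤ = ≤-trans (≤-reflexive (m≡m%n+[m/n]*n (labelledC5 G) 10))
      (+-monoˡ-≤ (c * 10) (s≤s⁻¹ (m%n<n (labelledC5 G) 10)))
    not-many : ¬ (s * (n * n) ≤ K * labelledC5 G)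
    not-many many = <⇒≱ (s≤s (m≤n+m (18 * K) N)) (≤-trans s₀≤s (≤-trans s≤ sn²≤18K))
      where
      n>0 : 1 ≤ n
      n>0 = ≤-trans (*-mono-≤ 1≤s 1≤s) s²≤n
      s≤ : s ≤ s * (n * n)
      s≤ = ≤-trans (≤-reflexive (≡-sym (*-identityʳ s))) (*-monoʳ-≤ s (*-mono-≤ n>0 n>0))
      e₁ : ∀ K c → 2 * (K * (9 + c * 10)) ≡ 18 * K + 20 * (K * c)
      e₁ = solve-∀
      sn²≤18K : s * (n * n) ≤ 18 * K
      sn²≤18K = +-cancelʳ-≤ (s * (n * n)) _ _ (begin
        s * (n * n) + s * (n * n)        ≡⟨ cong (s * (n * n) +_) (+-identityʳ (s * (n * n))) ⟨
        2 * (s * (n * n))                ≤⟨ *-monoʳ-≤ 2 (≤-trans many (*-monoʳ-≤ K labelled≤)) ⟩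
        2 * (K * (9 + c * 10))           ≡⟨ e₁ K c ⟩
        18 * K + 20 * (K * c)            ≤⟨ +-monoʳ-≤ (18 * K) (few-copies s n c K n≤4s² few) ⟩
        18 * K + s * (n * n)             ∎)
    go : s * (n * n) ≤ K * labelledC5 G ⊎
      (Σ (Graph n) λ H → H ⊆G G × labelledC5 H ≡ 0 × suc q * (edges G ∸ edges H) ≤ n * s) →
      Σ (Graph n) λ H → H ⊆G G × C5-free H ×
      (suc q ^ 2 * (edges G ∸ edges H) ^ 2 ≤ suc p ^ 2 * n ^ 3)
    go (inj₁ many) = contradiction many not-many
    go (inj₂ (H , H⊆G , e , removed≤)) = H , H⊆G , cong (_/ 10) e , (begin
      suc q ^ 2 * D ^ 2               ≡⟨ e₁ (suc q) D ⟩
      suc q * D * (suc q * D)         ≤⟨ *-mono-≤ removed≤ removed≤ ⟩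
      n * s * (n * s)                 ≡⟨ e₂ n s ⟩
      s * s * (n * n)                 ≤⟨ *-monoˡ-≤ (n * n) s²≤n ⟩
      n * (n * n)                     ≡⟨ e₃ n ⟩
      1 * n ^ 3                       ≤⟨ *-monoˡ-≤ (n ^ 3) (*-mono-≤ {1} {suc p} (s≤s z≤n) (*-mono-≤ {1} {suc p} {1} (s≤s z≤n) ≤-refl)) ⟩
      suc p ^ 2 * n ^ 3               ∎)
      where
      D : ℕ
      D = edges G ∸ edges H
      e₁ : ∀ q d → q * (q * 1) * (d * (d * 1)) ≡ q * d * (q * d)
      e₁ = solve-∀
      e₂ : ∀ n s → n * s * (n * s) ≡ s * s * (n * n)
      e₂ = solve-∀
      e₃ : ∀ n → n * (n * n) ≡ 1 * (n * (n * (n * 1)))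
      e₃ = solve-∀

theorem1p1 : (p q : ℕ) →
    Σ ℕ λ a → Σ ℕ λ b → Σ ℕ λ n₀ →
    (n : ℕ) → n₀ ≤ n → (G : Graph n) → C4-free G →
    suc b ^ 2 * copiesC5 G ^ 2 ≤ suc a ^ 2 * n ^ 5 →
    Σ (Graph n) λ H → H ⊆G G × C5-free H ×
    (suc q ^ 2 * (edges G ∸ edges H) ^ 2 ≤ suc p ^ 2 * n ^ 3)
theorem1p1 p q = removal⇒theorem p q (removal (suc q))
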